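{- Let $G$ be a finite bipartite graph with bipartition $(L,R)$, let $s,d$ be integers and let $\epsilon < \frac{1}{23}$ be a positive real number. Suppose each vertex in $L$ has degree exactly $3$, each vertex in $R$ has degree at most $d$, and $G$ is an $(s, 2-\frac{\epsilon}{2})$-expander. Then Coverer wins the cover game $\mathsf{CoverGame}(G,\mu)$ with $\mu = \frac{\epsilon s}{72 d + 2\epsilon} - d$.
   Context: A $(2,4)$-matching in a bipartite graph $G$ with bipartition $(L,R)$ is a subgraph $F$ of $G$ such that each connected component of $F$ is a tree with at most $4$ edges and each vertex of $V(F)\cap L$ has degree exactly $2$ in $F$; $F$ covers a vertex $v$ if $v \in V(F)$. A bipartite graph $G$ with bipartition $(L,R)$ is an $(s,\delta)$-expander if every $X \subseteq L$ with $|X| \le s$ satisfies $|N_G(X)| \geq \delta |X|$. The cover game $\mathsf{CoverGame}(G,\mu)$ is played between two players, Chooser and Coverer, who maintain a $(2,4)$-matching $F_i$ in $G$ (initially empty). At step $i+1$ Chooser may either (1) remove a connected component from $F_i$, or (2) if $F_i$ has strictly fewer than $\mu$ connected components, pick a vertex of $G$ and challenge Coverer to find a $(2,4)$-matching $F_{i+1}$ in $G$ such that every connected component of $F_i$ is also a connected component of $F_{i+1}$, and $F_{i+1}$ covers the picked vertex. Coverer loses if at some point she cannot answer a challenge; otherwise Coverer wins. "Coverer wins" means Coverer has a strategy that answers every challenge in every play of the game.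
   Formalization: The number ε is taken to be a positive rational below 1/23 rather than an arbitrary positive real number, and accordingly μ is rational. -}

module Defs where

open import Data.Bool using (Bool; true; false; if_then_else_; _∧_)
open import Data.Nat using (ℕ; zero; suc)
open import Data.Fin using (Fin)
open import Data.List using (List; []; _∷_; length; map)
open import Data.Nat.ListAction using (sum)
open import Data.Bool.ListAction using (any)
open import Data.List.Base using (allFin)
open import Data.List.Membership.Propositional using (_∈_)
open import Data.List.Relation.Unary.Unique.Propositional using (Unique)
open import Data.Integer using (ℤ)
open import Data.Rational using (ℚ; 0ℚ; _≟_; _÷_; ≢-nonZero; _*_; _-_; _+_; _≤_; _<_)
import Data.Rational as ℚ
open import Data.Sum using (_⊎_; inj₁; inj₂)
open import Data.Product using (Σ; _×_; _,_; ∃; ∃-syntax)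
open import Relation.Nullary using (¬_; yes; no)
open import Relation.Binary.PropositionalEquality using (_≡_)
open import Function.Bundles using (_⇔_)

ℕ→ℚ : ℕ → ℚ
ℕ→ℚ k = Data.Integer.+ k ℚ./ 1

ℤ→ℚ : ℤ → ℚ
ℤ→ℚ z = z ℚ./ 1

-- Total division on ℚ (returns 0 on division by 0; in the theorem the
-- divisor 72d + 2ε is never 0 because ε > 0 and d is an integer).
_÷'_ : ℚ → ℚ → ℚ
p ÷' q with q ≟ 0ℚ
... | yes _  = 0ℚ
... | no q≢0 = _÷_ p q {{≢-nonZero q≢0}}

card : ∀ {k} → (Fin k → Bool) → ℕ
card {k} X = sum (map (λ i → if X i then 1 else 0) (allFin k))

record BipGraph : Set where
  field
    m   : ℕ
    n   : ℕ
    adj : Fin m → Fin n → Bool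

module _ (G : BipGraph) where
  open BipGraph G

  Vertex : Set
  Vertex = Fin m ⊎ Fin n

  degL : Fin m → ℕ
  degL l = card (adj l)

  degR : Fin n → ℕ
  degR r = card (λ l → adj l r)

  nbhd : (Fin m → Bool) → (Fin n → Bool)
  nbhd X r = any (λ l → X l ∧ adj l r) (allFin m)

  IsExpander : ℤ → ℚ → Set
  IsExpander s δ = ∀ (X : Fin m → Bool) →
    ℤ→ℚ (Data.Integer.+ card X) ℚ.≤ ℤ→ℚ s →
    δ * ℕ→ℚ (card X) ℚ.≤ ℕ→ℚ (card (nbhd X))

  record Subgraph : Set where
    field
      V : Vertex → Bool
      E : Fin m → Fin n → Bool
      E⊆G  : ∀ l r → E l r ≡ true → adj l r ≡ true
      E→Vl : ∀ l r → E l r ≡ true → V (inj₁ l) ≡ true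
      E→Vr : ∀ l r → E l r ≡ true → V (inj₂ r) ≡ true

  open Subgraph public

  AdjF : Subgraph → Vertex → Vertex → Set
  AdjF F (inj₁ l) (inj₂ r) = E F l r ≡ true
  AdjF F (inj₂ r) (inj₁ l) = E F l r ≡ true
  AdjF F (inj₁ _) (inj₁ _) = Data.Empty.⊥ where import Data.Empty
  AdjF F (inj₂ _) (inj₂ _) = Data.Empty.⊥ where import Data.Empty

  data Reach (F : Subgraph) (u : Vertex) : Vertex → Set where
    here : V F u ≡ true → Reach F u u
    step : ∀ {w x} → Reach F u w → AdjF F w x → Reach F u x

  CyclicallyAdjacent : Subgraph → Vertex → List Vertex → Set
  CyclicallyAdjacent F first []           = Data.Unit.⊤ where import Data.Unit
  CyclicallyAdjacent F first (v ∷ [])     = AdjF F v first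
  CyclicallyAdjacent F first (v ∷ w ∷ vs) = AdjF F v w × CyclicallyAdjacent F first (w ∷ vs)

  IsCycle : Subgraph → List Vertex → Set
  IsCycle F []       = Data.Empty.⊥ where import Data.Empty
  IsCycle F (v ∷ vs) = Unique (v ∷ vs) × (3 Data.Nat.≤ length (v ∷ vs))
                       × CyclicallyAdjacent F v (v ∷ vs)
    where import Data.Nat

  Acyclic : Subgraph → Set
  Acyclic F = ∀ (cs : List Vertex) → ¬ IsCycle F cs

  ComponentEdgesAtMost : Subgraph → Vertex → ℕ → Set
  ComponentEdgesAtMost F v k =
    Σ (List (Fin m × Fin n)) λ es → (length es Data.Nat.≤ k) ×
      (∀ l r → E F l r ≡ true → Reach F v (inj₁ l) → (l , r) ∈ es)
    where import Data.Nat

  -- (2,4)-matching: every component is a tree (connected by definition,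
  -- and acyclic) with at most 4 edges, and every vertex of V(F) ∩ L has
  -- degree exactly 2 in F.
  Is24Matching : Subgraph → Set
  Is24Matching F =
    Acyclic F ×
    (∀ v → V F v ≡ true → ComponentEdgesAtMost F v 4) ×
    (∀ l → V F (inj₁ l) ≡ true → card (E F l) ≡ 2)

  Covers : Subgraph → Vertex → Set
  Covers F v = V F v ≡ true

  FewerComponentsThan : Subgraph → ℚ → Set
  FewerComponentsThan F μ =
    Σ (List Vertex) λ reps → (ℕ→ℚ (length reps) ℚ.< μ) ×
      (∀ u → V F u ≡ true → Σ Vertex λ w → (w ∈ reps) × Reach F w u)

  KeepsComponents : Subgraph → Subgraph → Set
  KeepsComponents F F' = ∀ v → V F v ≡ true →
    (∀ u → Reach F' v u ⇔ Reach F v u) ×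
    (∀ l r → Reach F v (inj₁ l) → (E F' l r ≡ true ⇔ E F l r ≡ true))

  RemoveComponent : Subgraph → Vertex → Subgraph → Set
  RemoveComponent F v F' =
    (∀ u → V F' u ≡ true ⇔ (V F u ≡ true × ¬ Reach F v u)) ×
    (∀ l r → E F' l r ≡ true ⇔ (E F l r ≡ true × ¬ Reach F v (inj₁ l)))

  emptySubgraph : Subgraph
  emptySubgraph = record
    { V = λ _ → false ; E = λ _ _ → false
    ; E⊆G = λ _ _ () ; E→Vl = λ _ _ () ; E→Vr = λ _ _ () }

  -- Coverer wins CoverGame(G, μ): there is a set W of positions
  -- ((2,4)-matchings) containing the empty one, closed under Chooser's
  -- removal moves, and such that from every position in W with fewer
  -- than μ components every challenge has an answer inside W.
  -- (Standard characterisation of winning strategies in safety games.)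
  CovererWins : ℚ → Set₁
  CovererWins μ = Σ (Subgraph → Set) λ W →
    W emptySubgraph ×
    (∀ F → W F → Is24Matching F) ×
    (∀ F v F' → W F → V F v ≡ true → RemoveComponent F v F' → W F') ×
    (∀ F → W F → FewerComponentsThan F μ → ∀ (v : Vertex) →
       Σ Subgraph λ F' → W F' × KeepsComponents F F' × Covers F' v)

{-# OPTIONS --safe #-}
module Submission where

-- Call an r ∈ N(X) private to l ∈ X if l is its only neighbour in X. Remove from X an l with
-- two private neighbours p, q (component p – l – q), or a pair l, l′ whose only common
-- neighbour r meets no other vertex of X and which have private neighbours p and q (component
-- p – l – r – l′ – q); neither removal affects the neighbourhoods of the other vertices of X.
-- When no such step is possible, a discharging argument gives 5 |N(X)| ≤ 9 |X|. In G minus the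
-- vertices of a position F with k components, which have at most 3k right vertices, expansion
-- then forces |X| ≤ 20 k. Hence if every set of size at most 20 k can be covered by a
-- (2,4)-matching extending F, so can every set of size at most s.
--
-- Coverer keeps the invariant that every set of size at most t can be covered by an extension
-- of the current position. It survives removals. If each of the O(d) candidate components
-- through a challenged l ∈ L broke it, the union of {l} and the offending sets would still
-- have size at most s and so could be covered, a contradiction. For a challenged r ∈ R she
-- first covers all its at most d neighbours (whence the summand - d in μ); if r is still
-- uncovered, it is added as a component without edges.

open import Defs
open import Data.Bool using (Bool)
open import Data.Nat using (ℕ)
open import Data.Integer using (ℤ)
open import Data.Fin using (Fin)
open import Relation.Binary.PropositionalEquality using (_≡_)

-- Finite sums, point masses and counting.

module FiniteSums where
  open import Data.Bool using (Bool; true; false; if_then_else_)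
  open import Data.Nat using (ℕ; zero; suc; _+_; _*_; _≤_; z≤n; s≤s)
  open import Data.Nat.Properties using (+-mono-≤; +-identityʳ; *-distribˡ-+; *-zeroʳ; ≤-reflexive; ≤-trans; +-commutativeSemigroup)
  open import Algebra.Properties.CommutativeSemigroup +-commutativeSemigroup using (interchange)
  open import Data.Nat.ListAction using (sum)
  open import Data.Fin using (Fin; zero; suc; _≟_)
  open import Data.List using (List; []; _∷_; map; allFin; filter; length)
  open import Data.List.Properties using (map-tabulate)
  open import Data.List.Membership.Propositional using (_∈_)
  open import Data.List.Relation.Unary.All using (All; []; _∷_)
  open import Data.List.Relation.Unary.Unique.Propositional using (Unique; []; _∷_)
  open import Data.List.Relation.Unary.Any using (here; there)
  open import Relation.Nullary using (does; yes; no)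
  open import Relation.Binary.PropositionalEquality using (_≡_; _≢_; refl; sym; trans; cong; cong₂; subst)
  open import Function using (_∘_; id)
  import Data.Bool

  private variable
    A B : Set
    k l : ℕ

  sumOver : List A → (A → ℕ) → ℕ
  sumOver xs f = sum (map f xs)

  sumOver-mono : (xs : List A) {f g : A → ℕ} → (∀ x → f x ≤ g x) → sumOver xs f ≤ sumOver xs g
  sumOver-mono []       f≤g = z≤n
  sumOver-mono (x ∷ xs) f≤g = +-mono-≤ (f≤g x) (sumOver-mono xs f≤g)

  sumOver-cong : (xs : List A) {g h : A → ℕ} → (∀ x → g x ≡ h x) → sumOver xs g ≡ sumOver xs h
  sumOver-cong []       g≗h = refl
  sumOver-cong (x ∷ xs) g≗h = cong₂ _+_ (g≗h x) (sumOver-cong xs g≗h)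

  sumOver-+ : (xs : List A) (f g : A → ℕ) →
              sumOver xs (λ x → f x + g x) ≡ sumOver xs f + sumOver xs g
  sumOver-+ []       f g = refl
  sumOver-+ (x ∷ xs) f g =
    trans (cong (f x + g x +_) (sumOver-+ xs f g)) (interchange (f x) (g x) _ _)

  sumOver-* : ∀ c (xs : List A) (f : A → ℕ) → sumOver xs (λ x → c * f x) ≡ c * sumOver xs f
  sumOver-* c []       f = sym (*-zeroʳ c)
  sumOver-* c (x ∷ xs) f =
    trans (cong (c * f x +_) (sumOver-* c xs f)) (sym (*-distribˡ-+ c (f x) _))

  sumOver-0 : (xs : List A) → sumOver xs (λ _ → 0) ≡ 0
  sumOver-0 []       = refl
  sumOver-0 (x ∷ xs) = sumOver-0 xs

  sumOver-comm : (xs : List A) (ys : List B) (w : A → B → ℕ) →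
                 sumOver xs (λ x → sumOver ys (w x)) ≡ sumOver ys (λ y → sumOver xs (λ x → w x y))
  sumOver-comm []       ys w = sym (sumOver-0 ys)
  sumOver-comm (x ∷ xs) ys w =
    trans (cong (sumOver ys (w x) +_) (sumOver-comm xs ys w)) (sym (sumOver-+ ys (w x) _))

  ∑ : (Fin k → ℕ) → ℕ
  ∑ {k} = sumOver (allFin k)

  ∑-suc : (f : Fin (suc k) → ℕ) → ∑ f ≡ f zero + ∑ (f ∘ suc)
  ∑-suc f = cong (λ ns → f zero + sum ns)
    (trans (map-tabulate suc f) (sym (map-tabulate id (f ∘ suc))))

  ⟦_⟧ : Bool → ℕ
  ⟦ b ⟧ = if b then 1 else 0

  -- The point mass of weight `c` at `i`.
  δ : Fin k → ℕ → Fin k → ℕ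
  δ i c j = if does (j ≟ i) then c else 0

  δ-diag : ∀ (i : Fin k) c {j} → j ≡ i → δ i c j ≡ c
  δ-diag i c {j} j≡i with j ≟ i
  ... | yes _  = refl
  ... | no j≢i with () ← j≢i j≡i

  δ-off : ∀ (i : Fin k) c {j} → j ≢ i → δ i c j ≡ 0
  δ-off i c {j} j≢i with j ≟ i
  ... | no _ = refl
  ... | yes j≡i with () ← j≢i j≡i

  ∑-δ : (i : Fin k) (c : ℕ) → ∑ (δ i c) ≡ c
  ∑-δ {suc k} zero    c = trans (∑-suc {k} (δ zero c))
    (trans (cong (c +_) (sumOver-0 (allFin k))) (+-identityʳ c))
  ∑-δ {suc k} (suc i) c = trans (∑-suc (δ (suc i) c)) (∑-δ i c)

  -- Repetitions in `is` are harmless: the multiplicities `occ` sum to at most the length of the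
  -- list, and every element of `P` has multiplicity at least 1.
  card-∈≤length : ∀ {P : Fin k → Bool} (is : List (Fin k)) →
                  (∀ i → P i ≡ true → i ∈ is) → card P ≤ length is
  card-∈≤length {k} {P} is P⊆is = ≤-trans (sumOver-mono (allFin k) le) (bound is)
    where
    occ : List (Fin k) → Fin k → ℕ
    occ []       j = 0
    occ (i ∷ is) j = δ i 1 j + occ is j
    bound : ∀ is → ∑ (occ is) ≤ length is
    bound []       = ≤-reflexive (sumOver-0 (allFin k))
    bound (i ∷ is) rewrite sumOver-+ (allFin k) (δ i 1) (occ is) | ∑-δ i 1 = s≤s (bound is)
    occ≥1 : ∀ {is j} → j ∈ is → 1 ≤ occ is j
    occ≥1 {i ∷ is} (here j≡i) rewrite δ-diag i 1 j≡i = s≤s z≤n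
    occ≥1 {i ∷ is} {j} (there j∈) = +-mono-≤ (z≤n {δ i 1 j}) (occ≥1 j∈)
    le : ∀ j → ⟦ P j ⟧ ≤ occ is j
    le j with P j in eq
    ... | false = z≤n
    ... | true  = occ≥1 (P⊆is j eq)

  elements : (Fin k → Bool) → List (Fin k)
  elements {k} X = filter (λ i → X i Data.Bool.≟ true) (allFin k)

  length-elements : (X : Fin k → Bool) → length (elements X) ≡ card X
  length-elements {k} X = go (allFin k)
    where
    go : ∀ is → length (filter (λ i → X i Data.Bool.≟ true) is) ≡ sumOver is (⟦_⟧ ∘ X)
    go []       = refl
    go (i ∷ is) with X i
    ... | true  = cong suc (go is)
    ... | false = go is

  -- Each `f i` is the total of the point mass `δ i (f i)`. After the two sums are exchanged, a
  -- fixed `j` receives at most one of these masses, because the list has no repetitions.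
  sumOver-unique≤∑ : (f : Fin k → ℕ) {is : List (Fin k)} → Unique is → sumOver is f ≤ ∑ f
  sumOver-unique≤∑ {k} f {is} uniq =
    subst (_≤ ∑ f) (trans (sumOver-comm (allFin k) is _) (sumOver-cong is (λ i → ∑-δ i (f i))))
      (sumOver-mono (allFin k) (pointwise uniq))
    where
    absent : ∀ {js} j → All (j ≢_) js → sumOver js (λ i → δ i (f i) j) ≡ 0
    absent j []                   = refl
    absent j (_∷_ {x = i} j≢i all) rewrite δ-off i (f i) j≢i = absent j all
    pointwise : ∀ {js} → Unique js → ∀ j → sumOver js (λ i → δ i (f i) j) ≤ f j
    pointwise []                      j = z≤n
    pointwise (_∷_ {x = i} i∉ uniq) j with j ≟ i
    ... | no  _    = pointwise uniq j
    ... | yes refl = ≤-reflexive (trans (cong (f i +_) (absent i i∉)) (+-identityʳ (f i)))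

-- Private neighbours and the discharging bound.

module Peeling {m n : ℕ} (adj : Fin m → Fin n → Bool) (free : Fin n → Bool) where
  open FiniteSums
  open import Data.Bool using (true; false; if_then_else_; _∧_)
  open import Data.Nat using (_+_; _*_; _≤_; z≤n; s≤s)
  open import Data.Nat.Properties using (≤-refl; ≤-reflexive; ≤-trans; +-mono-≤; *-monoʳ-≤; m≤m+n; module ≤-Reasoning)
  open import Data.Fin using (_≟_)
  open import Data.Fin.Properties using (any?; all?)
  open import Data.List using ([]; _∷_; allFin)
  open import Data.List.Relation.Unary.All using ([]; _∷_)
  open import Data.List.Relation.Unary.Unique.Propositional using ([]; _∷_)
  open import Data.Product using (∃; ∃-syntax; _×_; _,_; proj₁; proj₂)
  open import Data.Sum using (_⊎_; inj₁; inj₂)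
  open import Relation.Nullary using (Dec; does; yes; no; ¬_; ¬?; contradiction; _×-dec_; _⊎-dec_; _→-dec_)
  open import Relation.Nullary.Decidable using (dec-true; dec-false; decidable-stable)
  open import Relation.Binary.PropositionalEquality using (_≡_; _≢_; refl; sym; trans; cong; subst)
  open import Function using (_∘_)
  import Data.Bool as Bool

  _∼_ : Fin m → Fin n → Set
  l ∼ r = adj l r ≡ true

  _∼?_ : ∀ l r → Dec (l ∼ r)
  l ∼? r = adj l r Bool.≟ true

  module Residual (X : Fin m → Bool) where

    -- `free` marks the right vertices outside the current position, so a component built on private
    -- neighbours does not meet the position in these vertices.
    Private : Fin m → Fin n → Set
    Private l r = l ∼ r × free r ≡ true × (∀ l′ → X l′ ≡ true → l′ ∼ r → l′ ≡ l)

    HasPrivate : Fin m → Set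
    HasPrivate l = ∃ (Private l)

    TwoPrivate : Fin m → Set
    TwoPrivate l = X l ≡ true × ∃[ p ] ∃[ q ] p ≢ q × Private l p × Private l q

    SharedPair : Fin m → Fin m → Fin n → Set
    SharedPair l l′ r =
      X l ≡ true × X l′ ≡ true × l ≢ l′ × l ∼ r × l′ ∼ r × free r ≡ true ×
      (∀ l″ → X l″ ≡ true → l″ ∼ r → l″ ≡ l ⊎ l″ ≡ l′) × HasPrivate l × HasPrivate l′

    private? : ∀ l r → Dec (Private l r)
    private? l r = (l ∼? r) ×-dec (free r Bool.≟ true) ×-dec
      all? (λ l′ → (X l′ Bool.≟ true) →-dec (l′ ∼? r) →-dec (l′ ≟ l))

    hasPrivate? : ∀ l → Dec (HasPrivate l)
    hasPrivate? l = any? (private? l)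

    twoPrivate? : ∀ l → Dec (TwoPrivate l)
    twoPrivate? l = (X l Bool.≟ true) ×-dec
      any? (λ p → any? (λ q → ¬? (p ≟ q) ×-dec private? l p ×-dec private? l q))

    sharedPair? : ∀ l l′ r → Dec (SharedPair l l′ r)
    sharedPair? l l′ r =
      (X l Bool.≟ true) ×-dec (X l′ Bool.≟ true) ×-dec ¬? (l ≟ l′) ×-dec
      (l ∼? r) ×-dec (l′ ∼? r) ×-dec (free r Bool.≟ true) ×-dec
      all? (λ l″ → (X l″ Bool.≟ true) →-dec (l″ ∼? r) →-dec ((l″ ≟ l) ⊎-dec (l″ ≟ l′))) ×-dec
      hasPrivate? l ×-dec hasPrivate? l′

    module Stuck
      (deg≤3 : ∀ l → card (adj l) ≤ 3)
      (no-two : ∀ l → ¬ TwoPrivate l)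
      (no-pair : ∀ l l′ r → ¬ SharedPair l l′ r)
      where

      -- Discharging: each l ∈ X hands out at most 9 units in total (5 + 2 + 2 with a private
      -- neighbour, 3 + 3 + 3 without), and each free neighbour of X receives at least 5.
      share : Fin m → Fin n → ℕ
      share l r = if does (private? l r) then 5 else if does (hasPrivate? l) then 2 else 3

      charge : Fin m → Fin n → ℕ
      charge l r = if X l ∧ adj l r ∧ free r then share l r else 0

      charge-edge : ∀ {l r} → X l ≡ true → l ∼ r → free r ≡ true → charge l r ≡ share l r
      charge-edge l∈X l∼r r-free rewrite l∈X | l∼r | r-free = refl

      share-private : ∀ {l r} → Private l r → share l r ≡ 5
      share-private {l} {r} p rewrite dec-true (private? l r) p = refl

      share-≥3 : ∀ {l r} → ¬ HasPrivate l → 3 ≤ share l r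
      share-≥3 {l} {r} ¬p with does (private? l r)
      ... | true = s≤s (s≤s (s≤s z≤n))
      ... | false rewrite dec-false (hasPrivate? l) ¬p = ≤-refl

      share-≥2 : ∀ l r → 2 ≤ share l r
      share-≥2 l r with does (private? l r) | does (hasPrivate? l)
      ... | true  | _     = s≤s (s≤s z≤n)
      ... | false | true  = ≤-refl
      ... | false | false = s≤s (s≤s z≤n)

      row : ∀ l → ∑ (charge l) ≤ 9 * ⟦ X l ⟧
      row l with X l in l∈X
      ... | false = ≤-reflexive (sumOver-0 (allFin n))
      ... | true with hasPrivate? l
      ...   | no ¬p = begin
        sumOver (allFin n) _                          ≤⟨ sumOver-mono (allFin n) le ⟩
        ∑ (λ r → 3 * ⟦ adj l r ⟧)    ≡⟨ sumOver-* 3 (allFin n) (⟦_⟧ ∘ adj l) ⟩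
        3 * card (adj l)             ≤⟨ *-monoʳ-≤ 3 (deg≤3 l) ⟩
        9                            ∎
        where
        open ≤-Reasoning
        le′ : ∀ {r} a f (d : Dec (Private l r)) → (if a ∧ f then (if does d then 5 else 3) else 0) ≤ 3 * ⟦ a ⟧
        le′ false _     _       = z≤n
        le′ true  false _       = z≤n
        le′ true  true  (no _)  = ≤-refl
        le′ true  true  (yes p) = contradiction (_ , p) ¬p
        le : ∀ r → (if adj l r ∧ free r then (if does (private? l r) then 5 else 3) else 0) ≤ 3 * ⟦ adj l r ⟧
        le r = le′ (adj l r) (free r) (private? l r)
      ...   | yes (p , priv) = begin
        sumOver (allFin n) _                                    ≤⟨ sumOver-mono (allFin n) le ⟩
        -- The private neighbour `p` gets 5 = 2 + 3, hence the point mass; by `no-two` no other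
        -- neighbour of `l` is private.
        ∑ (λ r → 2 * ⟦ adj l r ⟧ + δ p 3 r)    ≡⟨ sumOver-+ (allFin n) _ (δ p 3) ⟩
        ∑ (λ r → 2 * ⟦ adj l r ⟧) + ∑ (δ p 3)  ≡⟨ cong (∑ (λ r → 2 * ⟦ adj l r ⟧) +_) (∑-δ p 3) ⟩
        ∑ (λ r → 2 * ⟦ adj l r ⟧) + 3          ≡⟨ cong (_+ 3) (sumOver-* 2 (allFin n) (⟦_⟧ ∘ adj l)) ⟩
        2 * card (adj l) + 3                   ≤⟨ +-mono-≤ (*-monoʳ-≤ 2 (deg≤3 l)) (≤-refl {3}) ⟩
        9                                      ∎
        where
        open ≤-Reasoning
        le′ : ∀ {r} a f (d : Dec (Private l r)) →
              (if a ∧ f then (if does d then 5 else 2) else 0) ≤ 2 * ⟦ a ⟧ + δ p 3 r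
        le′ false _     _        = z≤n
        le′ true  false _        = z≤n
        le′ true  true  (no _)   = s≤s (s≤s z≤n)
        le′ {r} true true (yes p′) with r ≟ p
        ... | yes _  = ≤-refl
        ... | no r≢p = contradiction (l∈X , r , p , r≢p , p′ , priv) (no-two l)
        le : ∀ r → (if adj l r ∧ free r then (if does (private? l r) then 5 else 2) else 0) ≤ 2 * ⟦ adj l r ⟧ + δ p 3 r
        le r = le′ (adj l r) (free r) (private? l r)

      -- By the number of neighbours of `r` in `X`: a single one has `r` as a private neighbour and
      -- gives 5; if there are exactly two, `no-pair` forces one of them to lack a private
      -- neighbour, which gives 3 + 2; three already give 2 + 2 + 2.
      column : ∀ r → free r ≡ true → ∃[ l ] X l ≡ true × l ∼ r → 5 ≤ ∑ (λ l → charge l r)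
      column r r-free (l₁ , l₁∈X , l₁∼r)
        with any? (λ l → ¬? (l ≟ l₁) ×-dec (X l Bool.≟ true) ×-dec (l ∼? r))
      ... | no none = ≤-trans
        (≤-trans (≤-reflexive (sym (trans (charge-edge l₁∈X l₁∼r r-free) (share-private priv))))
                 (m≤m+n (charge l₁ r) 0))
        (sumOver-unique≤∑ (λ l → charge l r) ([] ∷ []))
        where
        priv : Private l₁ r
        priv = l₁∼r , r-free , λ l l∈X l∼r →
          decidable-stable (l ≟ l₁) (λ l≢l₁ → none (l , l≢l₁ , l∈X , l∼r))
      ... | yes (l₂ , l₂≢l₁ , l₂∈X , l₂∼r)
        with any? (λ l → ¬? (l ≟ l₁) ×-dec ¬? (l ≟ l₂) ×-dec (X l Bool.≟ true) ×-dec (l ∼? r))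
      ...   | yes (l₃ , l₃≢l₁ , l₃≢l₂ , l₃∈X , l₃∼r) = ≤-trans (s≤s (s≤s (s≤s (s≤s (s≤s z≤n)))))
        (≤-trans (+-mono-≤ (≥2 l₁∈X l₁∼r) (+-mono-≤ (≥2 l₂∈X l₂∼r) (+-mono-≤ (≥2 l₃∈X l₃∼r) z≤n)))
        (sumOver-unique≤∑ (λ l → charge l r)
          ((l₂≢l₁ ∘ sym ∷ l₃≢l₁ ∘ sym ∷ []) ∷ (l₃≢l₂ ∘ sym ∷ []) ∷ [] ∷ [])))
        where
        ≥2 : ∀ {l} → X l ≡ true → l ∼ r → 2 ≤ charge l r
        ≥2 {l} l∈X l∼r = subst (2 ≤_) (sym (charge-edge l∈X l∼r r-free)) (share-≥2 l r)
      ...   | no none = ≤-trans (two (hasPrivate? l₁) (hasPrivate? l₂))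
        (sumOver-unique≤∑ (λ l → charge l r) ((l₂≢l₁ ∘ sym ∷ []) ∷ [] ∷ []))
        where
        ≥ : ∀ {l c} → X l ≡ true → l ∼ r → c ≤ share l r → c ≤ charge l r
        ≥ l∈X l∼r = subst (_ ≤_) (sym (charge-edge l∈X l∼r r-free))
        only : ∀ l → X l ≡ true → l ∼ r → l ≡ l₁ ⊎ l ≡ l₂
        only l l∈X l∼r with l ≟ l₁ | l ≟ l₂
        ... | yes e | _     = inj₁ e
        ... | no _  | yes e = inj₂ e
        ... | no l≢l₁ | no l≢l₂ = contradiction (l , l≢l₁ , l≢l₂ , l∈X , l∼r) none
        two : Dec (HasPrivate l₁) → Dec (HasPrivate l₂) → 5 ≤ charge l₁ r + (charge l₂ r + 0)
        two (no ¬p) _ = +-mono-≤ (≥ l₁∈X l₁∼r (share-≥3 ¬p)) (+-mono-≤ (≥ l₂∈X l₂∼r (share-≥2 l₂ r)) z≤n)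
        two (yes _) (no ¬p) = +-mono-≤ (≥ l₁∈X l₁∼r (share-≥2 l₁ r)) (+-mono-≤ (≥ l₂∈X l₂∼r (share-≥3 ¬p)) z≤n)
        two (yes p₁) (yes p₂) = contradiction
          (l₁∈X , l₂∈X , l₂≢l₁ ∘ sym , l₁∼r , l₂∼r , r-free , only , p₁ , p₂) (no-pair l₁ l₂ r)

      -- Double counting of the total charge, with `column` as the lower bound and `row` as the
      -- upper bound.
      stuck-bound : ∀ {N : Fin n → Bool} →
        (∀ r → N r ≡ true → free r ≡ true × ∃[ l ] X l ≡ true × l ∼ r) →
        5 * card N ≤ 9 * card X
      stuck-bound {N} N⊆ = begin
        5 * card N                             ≡⟨ sym (sumOver-* 5 (allFin n) (⟦_⟧ ∘ N)) ⟩
        ∑ (λ r → 5 * ⟦ N r ⟧)                  ≤⟨ sumOver-mono (allFin n) le ⟩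
        ∑ (λ r → ∑ (λ l → charge l r))         ≡⟨ sumOver-comm (allFin n) (allFin m) (λ r l → charge l r) ⟩
        ∑ (λ l → ∑ (charge l))                 ≤⟨ sumOver-mono (allFin m) row ⟩
        ∑ (λ l → 9 * ⟦ X l ⟧)                  ≡⟨ sumOver-* 9 (allFin m) (⟦_⟧ ∘ X) ⟩
        9 * card X                             ∎
        where
        open ≤-Reasoning
        le : ∀ r → 5 * ⟦ N r ⟧ ≤ ∑ (λ l → charge l r)
        le r with N r in r∈N
        ... | false = z≤n
        ... | true  = column r (proj₁ (N⊆ r r∈N)) (proj₂ (N⊆ r r∈N))

-- Components as explicit blocks, and extensions of positions.

module Blocks (G : BipGraph) where
  open FiniteSums
  open BipGraph G
  open import Data.Bool using (true; false; if_then_else_; _∧_; not)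
  open import Data.Nat using (zero; suc; _+_; _*_; _≤_; _<_; z≤n; s≤s)
  open import Data.Nat.Properties using (≤-refl; ≤-reflexive; ≤-trans; ≤-pred; <⇒≤; +-mono-≤; +-monoʳ-≤; +-monoˡ-≤; *-monoʳ-≤; *-monoˡ-≤; *-cancelˡ-≤; +-cancelˡ-≤; *-distribʳ-+; *-assoc; module ≤-Reasoning)
  open import Data.Fin using (_≟_)
  open import Data.Fin.Properties using (any?)
  open import Data.List using (List; []; _∷_; allFin; _++_; concatMap; length)
  open import Data.List.Properties using (length-++)
  open import Data.List.Membership.Propositional using (_∈_; find; lose)
  open import Data.List.Membership.Propositional.Properties using (∈-concatMap⁺; ∈-concatMap⁻; ∈-allFin; ∈-++⁺ˡ; ∈-++⁺ʳ; ∈-++⁻; ∈-filter⁺)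
  open import Data.List.Relation.Unary.Any as Any using (here; there)
  open import Data.List.Relation.Unary.Any.Properties using (any⁻)
  open import Data.List.Relation.Unary.All as All using (All; []; _∷_)
  open import Data.List.Relation.Binary.Subset.Propositional using (_⊆_)
  open import Data.Product using (∃-syntax; _×_; _,_; proj₁; proj₂)
  open import Data.Sum using (_⊎_; inj₁; inj₂)
  open import Data.Sum.Properties using (≡-dec)
  open import Data.Unit using (⊤; tt)
  open import Data.Empty using (⊥-elim)
  open import Relation.Nullary using (Dec; does; yes; no; ¬_; ¬?; _×-dec_)
  open import Relation.Nullary.Decidable using (dec-true; dec-false; map′)
  open import Relation.Binary.PropositionalEquality using (_≡_; _≢_; refl; sym; trans; cong; subst)
  open import Relation.Binary.Definitions using (DecidableEquality)
  open import Function using (_∘_)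
  import Data.Bool as Bool
  import Data.Bool.Properties as Bool
  import Data.List.Membership.DecPropositional as DecMembership

  _∼_ : Fin m → Fin n → Set
  l ∼ r = adj l r ≡ true

  -- A tree whose left vertices all have degree 2 has twice as many edges as left vertices, so with
  -- at most 4 edges it has at most two of them. These shapes are therefore all possible components,
  -- up to the order in which the vertices are written.
  data Block : Set where
    iso : Fin n → Block
    one : Fin m → Fin n → Fin n → Block
    two : Fin n → Fin m → Fin n → Fin m → Fin n → Block

  Position : Set
  Position = List Block

  verts : Block → List (Vertex G)
  verts (iso r)          = inj₂ r ∷ []
  verts (one l p q)      = inj₁ l ∷ inj₂ p ∷ inj₂ q ∷ []
  verts (two p l r l′ q) = inj₁ l ∷ inj₁ l′ ∷ inj₂ r ∷ inj₂ p ∷ inj₂ q ∷ []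

  WellFormed : Block → Set
  WellFormed (iso r)          = ⊤
  WellFormed (one l p q)      = l ∼ p × l ∼ q × p ≢ q
  WellFormed (two p l r l′ q) = l ∼ p × l ∼ r × l′ ∼ r × l′ ∼ q × l ≢ l′ × p ≢ r × r ≢ q × p ≢ q

  wellFormed? : ∀ b → Dec (WellFormed b)
  wellFormed? (iso r) = yes tt
  wellFormed? (one l p q) = (adj l p Bool.≟ true) ×-dec (adj l q Bool.≟ true) ×-dec ¬? (p ≟ q)
  wellFormed? (two p l r l′ q) =
    (adj l p Bool.≟ true) ×-dec (adj l r Bool.≟ true) ×-dec
    (adj l′ r Bool.≟ true) ×-dec (adj l′ q Bool.≟ true) ×-dec
    ¬? (l ≟ l′) ×-dec ¬? (p ≟ r) ×-dec ¬? (r ≟ q) ×-dec ¬? (p ≟ q)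

  not-does : ∀ {P : Set} (P? : Dec P) → not (does P?) ≡ true → ¬ P
  not-does (no ¬p) _ = ¬p

  infix 4 _∈ᵖ_
  _∈ᵖ_ : Vertex G → Position → Set
  v ∈ᵖ F = ∃[ b ] b ∈ F × v ∈ verts b

  vertex≟ : DecidableEquality (Vertex G)
  vertex≟ = ≡-dec _≟_ _≟_

  open DecMembership vertex≟ public using () renaming (_∈?_ to _∈ᵛ?_)

  _∈ᵖ?_ : ∀ v F → Dec (v ∈ᵖ F)
  v ∈ᵖ? F = map′ find (λ (b , b∈F , v∈b) → lose b∈F v∈b) (Any.any? (λ b → v ∈ᵛ? verts b) F)

  ∈ᵖ-mono : ∀ {v F F′} → F ⊆ F′ → v ∈ᵖ F → v ∈ᵖ F′
  ∈ᵖ-mono F⊆F′ (b , b∈F , v∈b) = b , F⊆F′ b∈F , v∈b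

  -- Two blocks with a common vertex coincide; repetitions in the list are allowed.
  record Valid (F : Position) : Set where
    field
      wf       : ∀ {b} → b ∈ F → WellFormed b
      coincide : ∀ {b b′ v} → b ∈ F → b′ ∈ F → v ∈ verts b → v ∈ verts b′ → b ≡ b′
  open Valid public

  Fresh : Block → Position → Set
  Fresh b F = All (λ v → ¬ v ∈ᵖ F) (verts b)

  fresh? : ∀ b F → Dec (Fresh b F)
  fresh? b F = All.all? (λ v → ¬? (v ∈ᵖ? F)) (verts b)

  valid-[] : Valid []
  valid-[] = record { wf = λ () ; coincide = λ () }

  valid-++ : ∀ {F F′} → Valid F → Valid F′ →
             (∀ {v} → v ∈ᵖ F → ¬ v ∈ᵖ F′) → Valid (F ++ F′)
  valid-++ {F} {F′} VF VF′ disjoint = record { wf = wf′ ; coincide = coincide′ }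
    where
    wf′ : ∀ {b} → b ∈ F ++ F′ → WellFormed b
    wf′ b∈ with ∈-++⁻ F b∈
    ... | inj₁ b∈F  = wf VF b∈F
    ... | inj₂ b∈F′ = wf VF′ b∈F′
    coincide′ : ∀ {b b′ v} → b ∈ F ++ F′ → b′ ∈ F ++ F′ → v ∈ verts b → v ∈ verts b′ → b ≡ b′
    coincide′ b∈ b′∈ v∈b v∈b′ with ∈-++⁻ F b∈ | ∈-++⁻ F b′∈
    ... | inj₁ x | inj₁ y = coincide VF x y v∈b v∈b′
    ... | inj₁ x | inj₂ y = ⊥-elim (disjoint (_ , x , v∈b) (_ , y , v∈b′))
    ... | inj₂ x | inj₁ y = ⊥-elim (disjoint (_ , y , v∈b′) (_ , x , v∈b))
    ... | inj₂ x | inj₂ y = coincide VF′ x y v∈b v∈b′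

  valid-single : ∀ {b} → WellFormed b → Valid (b ∷ [])
  valid-single wf-b = record
    { wf       = λ { (here refl) → wf-b }
    ; coincide = λ { (here refl) (here refl) _ _ → refl } }

  valid-∷ : ∀ {b F} → WellFormed b → Fresh b F → Valid F → Valid (b ∷ F)
  valid-∷ wf-b fresh VF = valid-++ (valid-single wf-b) VF
    λ { (_ , here refl , v∈b) → All.lookup fresh v∈b }

  Extendable : Position → List (Fin m) → Set
  Extendable F A = ∃[ F′ ] F ⊆ F′ × Valid F′ × (∀ {l} → l ∈ A → inj₁ l ∈ᵖ F′)

  neighbour : ∀ b {r} → WellFormed b → inj₂ r ∈ verts b →
              b ≡ iso r ⊎ ∃[ l ] inj₁ l ∈ verts b × l ∼ r
  neighbour (iso r) _ (here refl) = inj₁ refl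
  neighbour (one l p q) (l∼p , _) (there (here refl)) = inj₂ (l , here refl , l∼p)
  neighbour (one l p q) (_ , l∼q , _) (there (there (here refl))) = inj₂ (l , here refl , l∼q)
  neighbour (two p l r l′ q) (_ , l∼r , _) (there (there (here refl))) = inj₂ (l , here refl , l∼r)
  neighbour (two p l r l′ q) (l∼p , _) (there (there (there (here refl)))) = inj₂ (l , here refl , l∼p)
  neighbour (two p l r l′ q) (_ , _ , _ , l′∼q , _) (there (there (there (there (here refl))))) =
    inj₂ (l′ , there (here refl) , l′∼q)

  module Trimming (Y : Fin m → Bool) where

    -- An extension may use left vertices outside `Y`. Trimming cuts a block down to the edges at
    -- its left vertices in `Y`, each of which keeps both of its edges; every block leaves at most
    -- one block. Afterwards each right vertex still in use has a neighbour in `Y`.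
    trim : Block → List Block
    trim (iso r) = []
    trim (one l p q) = if Y l then one l p q ∷ [] else []
    trim (two p l r l′ q) =
      if Y l then (if Y l′ then two p l r l′ q ∷ [] else one l p r ∷ [])
             else (if Y l′ then one l′ r q ∷ [] else [])

    trim-unique : ∀ b {b₁ b₂} → b₁ ∈ trim b → b₂ ∈ trim b → b₁ ≡ b₂
    trim-unique (one l p q) x y with Y l
    trim-unique (one l p q) (here refl) (here refl) | true = refl
    trim-unique (two p l r l′ q) x y with Y l | Y l′
    trim-unique (two p l r l′ q) (here refl) (here refl) | true  | true  = refl
    trim-unique (two p l r l′ q) (here refl) (here refl) | true  | false = refl
    trim-unique (two p l r l′ q) (here refl) (here refl) | false | true  = refl

    trim-⊆ : ∀ b {b′} → b′ ∈ trim b → verts b′ ⊆ verts b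
    trim-⊆ (one l p q) x with Y l
    trim-⊆ (one l p q) (here refl) | true = λ v∈ → v∈
    trim-⊆ (two p l r l′ q) x with Y l | Y l′
    trim-⊆ (two p l r l′ q) (here refl) | true  | true  = λ v∈ → v∈
    trim-⊆ (two p l r l′ q) (here refl) | true  | false = λ
      { (here refl)                 → here refl
      ; (there (here refl))         → there (there (there (here refl)))
      ; (there (there (here refl))) → there (there (here refl)) }
    trim-⊆ (two p l r l′ q) (here refl) | false | true  = λ
      { (here refl)                 → there (here refl)
      ; (there (here refl))         → there (there (here refl))
      ; (there (there (here refl))) → there (there (there (there (here refl)))) }

    trim-wf : ∀ b {b′} → WellFormed b → b′ ∈ trim b → WellFormed b′
    trim-wf (one l p q) w x with Y l
    trim-wf (one l p q) w (here refl) | true = w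
    trim-wf (two p l r l′ q) w x with Y l | Y l′
    trim-wf (two p l r l′ q) w (here refl) | true  | true  = w
    trim-wf (two p l r l′ q) (l∼p , l∼r , _ , _ , _ , p≢r , _) (here refl) | true  | false = l∼p , l∼r , p≢r
    trim-wf (two p l r l′ q) (_ , _ , l′∼r , l′∼q , _ , _ , r≢q , _) (here refl) | false | true  = l′∼r , l′∼q , r≢q

    trim-left : ∀ b {b′ l} → b′ ∈ trim b → inj₁ l ∈ verts b′ → Y l ≡ true
    trim-left (one l p q) x l∈ with Y l in eq
    trim-left (one l p q) (here refl) (here refl) | true = eq
    trim-left (one l p q) (here refl) (there (there (there ()))) | true
    trim-left (two p l r l′ q) x l∈ with Y l in eq | Y l′ in eq′
    trim-left (two p l r l′ q) (here refl) (here refl) | true  | true  = eq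
    trim-left (two p l r l′ q) (here refl) (there (here refl)) | true  | true  = eq′
    trim-left (two p l r l′ q) (here refl) (there (there (there (there (there ()))))) | true  | true
    trim-left (two p l r l′ q) (here refl) (here refl) | true  | false = eq
    trim-left (two p l r l′ q) (here refl) (there (there (there ()))) | true  | false
    trim-left (two p l r l′ q) (here refl) (here refl) | false | true = eq′
    trim-left (two p l r l′ q) (here refl) (there (there (there ()))) | false | true

    trim-covers : ∀ b {l} → inj₁ l ∈ verts b → Y l ≡ true → inj₁ l ∈ᵖ trim b
    trim-covers (iso r) (there ()) _
    trim-covers (one l p q) (here refl) l∈Y rewrite l∈Y = _ , here refl , here refl
    trim-covers (one l p q) (there (there (there ()))) _
    trim-covers (two p l r l′ q) (here refl) l∈Y rewrite l∈Y with Y l′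
    ... | true  = _ , here refl , here refl
    ... | false = _ , here refl , here refl
    trim-covers (two p l r l′ q) (there (here refl)) l∈Y rewrite l∈Y with Y l
    ... | true  = _ , here refl , there (here refl)
    ... | false = _ , here refl , here refl
    trim-covers (two p l r l′ q) (there (there (there (there (there ()))))) _

    iso∉trim : ∀ b {r} → ¬ iso r ∈ trim b
    iso∉trim (one l p q) x with Y l
    iso∉trim (one l p q) (there ()) | true
    iso∉trim (two p l r l′ q) x with Y l | Y l′
    iso∉trim (two p l r l′ q) (there ()) | true  | true
    iso∉trim (two p l r l′ q) (there ()) | true  | false
    iso∉trim (two p l r l′ q) (there ()) | false | true

    trim-neighbour : ∀ b {b′ r} → WellFormed b → b′ ∈ trim b → inj₂ r ∈ verts b′ →
                     ∃[ l ] inj₁ l ∈ verts b′ × l ∼ r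
    trim-neighbour b {b′} wf-b b′∈ r∈b′ with neighbour b′ (trim-wf b wf-b b′∈) r∈b′
    ... | inj₁ refl = ⊥-elim (iso∉trim b b′∈)
    ... | inj₂ found = found

  -- Passing from small sets to large sets by expansion.

  module Hall (deg≡3 : ∀ l → degL G l ≡ 3) (s : ℕ)
              (expansion : ∀ X → card X ≤ s → 39 * card X ≤ 20 * card (nbhd G X)) where

    module Over (F : Position) (VF : Valid F) where

      free : Fin n → Bool
      free r = not (does (inj₂ r ∈ᵖ? F))

      free⇒∉ : ∀ {r} → free r ≡ true → ¬ inj₂ r ∈ᵖ F
      free⇒∉ {r} = not-does (inj₂ r ∈ᵖ? F)

      ∉⇒free : ∀ {r} → ¬ inj₂ r ∈ᵖ F → free r ≡ true
      ∉⇒free {r} r∉F rewrite dec-false (inj₂ r ∈ᵖ? F) r∉F = refl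

      open Peeling adj free using (module Residual)

      -- `right` asks for a neighbour in `X` and not only for freeness: this keeps a cover of the
      -- remaining set away from the right vertices of a block that was peeled off.
      record Cover (X : Fin m → Bool) : Set where
        field
          blocks : Position
          valid  : Valid blocks
          left   : ∀ {l} → inj₁ l ∈ᵖ blocks → X l ≡ true
          right  : ∀ {r} → inj₂ r ∈ᵖ blocks → free r ≡ true × ∃[ l ] X l ≡ true × l ∼ r
          covers : ∀ {l} → X l ≡ true → inj₁ l ∈ᵖ blocks

      without : Block → (Fin m → Bool) → Fin m → Bool
      without b X l = X l ∧ not (does (inj₁ l ∈ᵛ? verts b))

      ∈-without : ∀ b X {l} → without b X l ≡ true → X l ≡ true × ¬ inj₁ l ∈ verts b
      ∈-without b X {l} e with X l | inj₁ l ∈ᵛ? verts b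
      ... | true | no l∉b = refl , l∉b

      without-∈ : ∀ b X {l} → X l ≡ true → ¬ inj₁ l ∈ verts b → without b X l ≡ true
      without-∈ b X {l} l∈X l∉b rewrite l∈X | dec-false (inj₁ l ∈ᵛ? verts b) l∉b = refl

      card-without : ∀ b X {l} → X l ≡ true → inj₁ l ∈ verts b → card (without b X) < card X
      card-without b X {l} l∈X l∈b = begin
        1 + card (without b X)                         ≡⟨ cong (_+ card (without b X)) (sym (∑-δ l 1)) ⟩
        ∑ (δ l 1) + card (without b X)                 ≡⟨ sym (sumOver-+ (allFin m) (δ l 1) _) ⟩
        ∑ (λ j → δ l 1 j + ⟦ without b X j ⟧)          ≤⟨ sumOver-mono (allFin m) le ⟩
        card X                                         ∎
        where
        open ≤-Reasoning
        le : ∀ j → δ l 1 j + ⟦ without b X j ⟧ ≤ ⟦ X j ⟧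
        le j with j ≟ l
        ... | yes refl rewrite l∈X | dec-true (inj₁ l ∈ᵛ? verts b) l∈b = ≤-refl
        ... | no _ with X j
        ...   | false = z≤n
        ...   | true with does (inj₁ j ∈ᵛ? verts b)
        ...     | true  = z≤n
        ...     | false = ≤-refl

      -- b exhausts the X-neighbours of its own right vertices, so it cannot clash with a cover of the rest.
      add-block : ∀ {X} b → WellFormed b →
                  (∀ {l} → inj₁ l ∈ verts b → X l ≡ true) →
                  (∀ {r} → inj₂ r ∈ verts b → free r ≡ true × (∃[ l ] inj₁ l ∈ verts b × l ∼ r) ×
                                               (∀ l → X l ≡ true → l ∼ r → inj₁ l ∈ verts b)) →
                  Cover (without b X) → Cover X
      add-block {X} b wf-b b⊆X b-right C = record
        { blocks = b ∷ blocks
        ; valid  = valid-∷ wf-b (All.tabulate λ {v} → disjoint v) valid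
        ; left   = λ { (_ , here refl , l∈b) → b⊆X l∈b
                     ; (b′ , there b′∈ , l∈b′) → proj₁ (∈-without b X (left (b′ , b′∈ , l∈b′))) }
        ; right  = right′
        ; covers = covers′ }
        where
        open Cover C
        disjoint : ∀ v → v ∈ verts b → ¬ v ∈ᵖ blocks
        disjoint (inj₁ l) l∈b l∈ = proj₂ (∈-without b X (left l∈)) l∈b
        disjoint (inj₂ r) r∈b r∈ =
          let _ , l , l∈X′ , l∼r = right r∈
              l∈X , l∉b = ∈-without b X l∈X′
          in l∉b (proj₂ (proj₂ (b-right r∈b)) l l∈X l∼r)
        right′ : ∀ {r} → inj₂ r ∈ᵖ (b ∷ blocks) → free r ≡ true × ∃[ l ] X l ≡ true × l ∼ r
        right′ (_ , here refl , r∈b) =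
          let r-free , (l , l∈b , l∼r) , _ = b-right r∈b in r-free , l , b⊆X l∈b , l∼r
        right′ (b′ , there b′∈ , r∈b′) =
          let r-free , l , l∈X′ , l∼r = right (b′ , b′∈ , r∈b′)
          in r-free , l , proj₁ (∈-without b X l∈X′) , l∼r
        covers′ : ∀ {l} → X l ≡ true → inj₁ l ∈ᵖ (b ∷ blocks)
        covers′ {l} l∈X with inj₁ l ∈ᵛ? verts b
        ... | yes l∈b = b , here refl , l∈b
        ... | no  l∉b = ∈ᵖ-mono there (covers (without-∈ b X l∈X l∉b))

      -- Trimming discards the blocks of `F`, which contain no vertex of `X`. A right vertex that is
      -- left over cannot lie in `F`: its block in `F′` would then be a block of `F` and yet contain
      -- a left vertex from `X`.
      cover-from-extension : ∀ {X} → (∀ {l} → X l ≡ true → ¬ inj₁ l ∈ᵖ F) →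
                             Extendable F (elements X) → Cover X
      cover-from-extension {X} X∩F=∅ (F′ , F⊆F′ , VF′ , cov) = record
        { blocks = concatMap trim F′
        ; valid  = record
          { wf = λ b∈ → let b₀ , b₀∈ , b∈′ = origin b∈ in trim-wf b₀ (wf VF′ b₀∈) b∈′
          ; coincide = coincide′ }
        ; left   = λ (b , b∈ , l∈b) → let b₀ , _ , b∈′ = origin b∈ in trim-left b₀ b∈′ l∈b
        ; right  = right′
        ; covers = covers′ }
        where
        open Trimming X
        origin : ∀ {b} → b ∈ concatMap trim F′ → ∃[ b₀ ] b₀ ∈ F′ × b ∈ trim b₀
        origin b∈ = find (∈-concatMap⁻ trim b∈)
        coincide′ : ∀ {b b′ v} → b ∈ concatMap trim F′ → b′ ∈ concatMap trim F′ →
                    v ∈ verts b → v ∈ verts b′ → b ≡ b′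
        coincide′ b∈ b′∈ v∈b v∈b′ with origin b∈ | origin b′∈
        ... | b₀ , b₀∈ , x | b₁ , b₁∈ , y
          with refl ← coincide VF′ b₀∈ b₁∈ (trim-⊆ b₀ x v∈b) (trim-⊆ b₁ y v∈b′) = trim-unique b₀ x y
        right′ : ∀ {r} → inj₂ r ∈ᵖ concatMap trim F′ → free r ≡ true × ∃[ l ] X l ≡ true × l ∼ r
        right′ {r} (b , b∈ , r∈b) with origin b∈
        ... | b₀ , b₀∈ , x with trim-neighbour b₀ (wf VF′ b₀∈) x r∈b
        ...   | l , l∈b , l∼r = ∉⇒free r∉F , l , trim-left b₀ x l∈b , l∼r
          where
          r∉F : ¬ inj₂ r ∈ᵖ F
          r∉F (b₁ , b₁∈ , r∈b₁)
            with refl ← coincide VF′ b₀∈ (F⊆F′ b₁∈) (trim-⊆ b₀ x r∈b) r∈b₁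
            = X∩F=∅ (trim-left b₀ x l∈b) (b₀ , b₁∈ , trim-⊆ b₀ x l∈b)
        covers′ : ∀ {l} → X l ≡ true → inj₁ l ∈ᵖ concatMap trim F′
        covers′ {l} l∈X
          with b₀ , b₀∈ , l∈b₀ ← cov (∈-filter⁺ (λ i → X i Bool.≟ true) (∈-allFin l) l∈X)
          with b , b∈ , l∈b ← trim-covers b₀ l∈b₀ l∈X
          = b , ∈-concatMap⁺ trim (lose b₀∈ b∈) , l∈b

      rights : Block → List (Fin n)
      rights (iso r)          = r ∷ []
      rights (one l p q)      = p ∷ q ∷ []
      rights (two p l r l′ q) = r ∷ p ∷ q ∷ []

      ∈-rights : ∀ b {r} → inj₂ r ∈ verts b → r ∈ rights b
      ∈-rights (iso r) (here refl) = here refl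
      ∈-rights (one l p q) (there (here refl)) = here refl
      ∈-rights (one l p q) (there (there (here refl))) = there (here refl)
      ∈-rights (two p l r l′ q) (there (there (here refl))) = here refl
      ∈-rights (two p l r l′ q) (there (there (there (here refl)))) = there (here refl)
      ∈-rights (two p l r l′ q) (there (there (there (there (here refl))))) = there (there (here refl))

      length-rights : ∀ b → length (rights b) ≤ 3
      length-rights (iso r)          = s≤s z≤n
      length-rights (one l p q)      = s≤s (s≤s z≤n)
      length-rights (two p l r l′ q) = ≤-refl

      length-concatRights : ∀ F → length (concatMap rights F) ≤ length F * 3
      length-concatRights []      = z≤n
      length-concatRights (b ∷ F) rewrite length-++ (rights b) {concatMap rights F} =
        +-mono-≤ (length-rights b) (length-concatRights F)

      card-taken : card (not ∘ free) ≤ length F * 3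
      card-taken = ≤-trans (card-∈≤length (concatMap rights F) taken) (length-concatRights F)
        where
        taken : ∀ r → not (free r) ≡ true → r ∈ concatMap rights F
        taken r e with inj₂ r ∈ᵖ? F
        ... | yes (b , b∈F , r∈b) = ∈-concatMap⁺ rights (lose b∈F (∈-rights b r∈b))
        ... | no r∉F with () ← trans (sym e) (cong not (∉⇒free r∉F))

      freeNbhd : (Fin m → Bool) → Fin n → Bool
      freeNbhd X r = nbhd G X r ∧ free r

      ∈-freeNbhd : ∀ X r → freeNbhd X r ≡ true → free r ≡ true × ∃[ l ] X l ≡ true × l ∼ r
      ∈-freeNbhd X r e with nbhd G X r in r∈N | free r
      ... | true | true
        with l , _ , t ← find (any⁻ (λ l → X l ∧ adj l r) (allFin m) (subst Bool.T (sym r∈N) tt))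
        with l∈X , l∼r ← Bool.T-∧ .Function.Equivalence.to t
        = refl , l , Bool.T-≡ .Function.Equivalence.to l∈X , Bool.T-≡ .Function.Equivalence.to l∼r

      card-nbhd : ∀ X → card (nbhd G X) ≤ card (freeNbhd X) + length F * 3
      card-nbhd X = begin
        card (nbhd G X)                                       ≤⟨ sumOver-mono (allFin n) le ⟩
        ∑ (λ r → ⟦ freeNbhd X r ⟧ + ⟦ not (free r) ⟧)         ≡⟨ sumOver-+ (allFin n) _ _ ⟩
        card (freeNbhd X) + card (not ∘ free)                 ≤⟨ +-monoʳ-≤ (card (freeNbhd X)) card-taken ⟩
        card (freeNbhd X) + length F * 3                      ∎
        where
        open ≤-Reasoning
        le : ∀ r → ⟦ nbhd G X r ⟧ ≤ ⟦ freeNbhd X r ⟧ + ⟦ not (free r) ⟧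
        le r with nbhd G X r | free r
        ... | false | _     = z≤n
        ... | true  | true  = ≤-refl
        ... | true  | false = ≤-refl

      -- With `x = card X` and `N` the number of free neighbours, expansion gives 39 x ≤ 20 (N + 3
      -- k), because at most 3 k right vertices are taken, and the discharging bound gives 20 N ≤ 36
      -- x. Hence 3 x ≤ 60 k.
      stuck-small : ∀ {k} X → length F ≤ k → card X ≤ s →
                    5 * card (freeNbhd X) ≤ 9 * card X → card X ≤ 20 * k
      stuck-small {k} X F≤k X≤s stuck = *-cancelˡ-≤ 3 (+-cancelˡ-≤ (36 * x) _ _ (begin
        36 * x + 3 * x             ≡⟨ sym (*-distribʳ-+ x 36 3) ⟩
        39 * x                     ≤⟨ expansion X X≤s ⟩
        20 * card (nbhd G X)       ≤⟨ *-monoʳ-≤ 20 (card-nbhd X) ⟩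
        20 * (N + length F * 3)    ≤⟨ *-monoʳ-≤ 20 (+-monoʳ-≤ N (*-monoˡ-≤ 3 F≤k)) ⟩
        20 * (N + k * 3)           ≡⟨ rearrange N k ⟩
        4 * (5 * N) + 3 * (20 * k) ≤⟨ +-monoˡ-≤ (3 * (20 * k)) (*-monoʳ-≤ 4 stuck) ⟩
        4 * (9 * x) + 3 * (20 * k) ≡⟨ cong (_+ 3 * (20 * k)) (sym (*-assoc 4 9 x)) ⟩
        36 * x + 3 * (20 * k)      ∎))
        where
        open ≤-Reasoning
        open import Data.Nat.Solver using (module +-*-Solver)
        open +-*-Solver
        x = card X
        N = card (freeNbhd X)
        rearrange : ∀ N k → 20 * (N + k * 3) ≡ 4 * (5 * N) + 3 * (20 * k)
        rearrange = solve 2 (λ N k → con 20 :* (N :+ k :* con 3)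
          := con 4 :* (con 5 :* N) :+ con 3 :* (con 20 :* k)) refl

      module _ {k} (F≤k : length F ≤ k) (small : ∀ A → length A ≤ 20 * k → Extendable F A) where

        -- Each block removed contains a vertex of `X`, so `fuel`, a bound on `card X`, can
        -- decrease. When no block can be removed, the rest has at most `20 * k` elements and
        -- `small` covers it.
        peel : ∀ fuel X → card X ≤ fuel → card X ≤ s →
               (∀ {l} → X l ≡ true → ¬ inj₁ l ∈ᵖ F) → Cover X
        peel-block : ∀ fuel {X} b l → card X ≤ fuel → card X ≤ s →
                     (∀ {l} → X l ≡ true → ¬ inj₁ l ∈ᵖ F) →
                     WellFormed b → inj₁ l ∈ verts b →
                     (∀ {l} → inj₁ l ∈ verts b → X l ≡ true) →
                     (∀ {r} → inj₂ r ∈ verts b → free r ≡ true × (∃[ l ] inj₁ l ∈ verts b × l ∼ r) ×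
                                                  (∀ l → X l ≡ true → l ∼ r → inj₁ l ∈ verts b)) →
                     Cover X

        peel-block zero {X} b l X≤0 X≤s X∩F wf-b l∈b b⊆X b-right
          with () ← ≤-trans (card-without b X (b⊆X l∈b) l∈b) X≤0
        peel-block (suc fuel) {X} b l X≤f X≤s X∩F wf-b l∈b b⊆X b-right =
          add-block b wf-b b⊆X b-right
            (peel fuel (without b X) (≤-pred (≤-trans lt X≤f)) (≤-trans (<⇒≤ lt) X≤s)
                  (λ e → X∩F (proj₁ (∈-without b X e))))
          where lt = card-without b X (b⊆X l∈b) l∈b

        peel fuel X X≤f X≤s X∩F with any? twoPrivate?
          where open Residual X
        ... | yes (l , l∈X , p , q , p≢q , (l∼p , p-free , p-only) , (l∼q , q-free , q-only)) =
          peel-block fuel (one l p q) l X≤f X≤s X∩F (l∼p , l∼q , p≢q) (here refl)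
            (λ { (here refl) → l∈X ; (there (there (there ()))) })
            (λ { (there (here refl)) → p-free , (l , here refl , l∼p) ,
                                       λ l′ l′∈X l′∼p → here (cong inj₁ (p-only l′ l′∈X l′∼p))
               ; (there (there (here refl))) → q-free , (l , here refl , l∼q) ,
                                       λ l′ l′∈X l′∼q → here (cong inj₁ (q-only l′ l′∈X l′∼q)) })
        ... | no no-two with any? (λ l → any? (λ l′ → any? (sharedPair? l l′)))
          where open Residual X
        ... | no no-pair = cover-from-extension X∩F
          (small (elements X) (subst (_≤ 20 * k) (sym (length-elements X))
            (stuck-small X F≤k X≤s (stuck-bound (∈-freeNbhd X)))))
          where
          open Residual X
          open Stuck (λ l → ≤-reflexive (deg≡3 l)) (λ l t → no-two (l , t))
                     (λ l l′ r t → no-pair (l , l′ , r , t))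
        ... | yes (l , l′ , r , l∈X , l′∈X , l≢l′ , l∼r , l′∼r , r-free , r-only ,
                   (p , l∼p , p-free , p-only) , (q , l′∼q , q-free , q-only)) =
          peel-block fuel (two p l r l′ q) l X≤f X≤s X∩F
            (l∼p , l∼r , l′∼r , l′∼q , l≢l′ ,
             -- The private neighbours `p` and `q` differ from `r`, which is adjacent to both left
             -- vertices, and from each other, since `q` is not adjacent to `l`.
             (λ { refl → l≢l′ (sym (p-only l′ l′∈X l′∼r)) }) ,
             (λ { refl → l≢l′ (q-only l l∈X l∼r) }) ,
             (λ { refl → l≢l′ (q-only l l∈X l∼p) }))
            (here refl)
            (λ { (here refl) → l∈X ; (there (here refl)) → l′∈X
               ; (there (there (there (there (there ()))))) })
            (λ { (there (there (here refl))) → r-free , (l , here refl , l∼r) , only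
               ; (there (there (there (here refl)))) → p-free , (l , here refl , l∼p) ,
                   λ i i∈X i∼p → here (cong inj₁ (p-only i i∈X i∼p))
               ; (there (there (there (there (here refl))))) → q-free , (l′ , there (here refl) , l′∼q) ,
                   λ i i∈X i∼q → there (here (cong inj₁ (q-only i i∈X i∼q))) })
          where
          only : ∀ i → X i ≡ true → i ∼ r → inj₁ i ∈ verts (two p l r l′ q)
          only i i∈X i∼r with r-only i i∈X i∼r
          ... | inj₁ refl = here refl
          ... | inj₂ refl = there (here refl)

        -- Only the elements of `A` outside `F` are peeled. Their cover uses free right vertices and
        -- left vertices outside `F`, so it can be joined to `F`.
        extend : ∀ A → length A ≤ s → Extendable F A
        extend A A≤s = blocks ++ F , ∈-++⁺ʳ blocks , valid-++ valid VF (λ {v} → disjoint v) , cov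
          where
          open DecMembership (_≟_ {m}) using (_∈?_)
          X : Fin m → Bool
          X l = does (l ∈? A) ∧ not (does (inj₁ l ∈ᵖ? F))
          ∈X : ∀ l → X l ≡ true → l ∈ A × ¬ inj₁ l ∈ᵖ F
          ∈X l e with l ∈? A
          ... | yes l∈A = l∈A , not-does (inj₁ l ∈ᵖ? F) e
          X∋ : ∀ {l} → l ∈ A → ¬ inj₁ l ∈ᵖ F → X l ≡ true
          X∋ {l} l∈A l∉F rewrite dec-true (l ∈? A) l∈A | dec-false (inj₁ l ∈ᵖ? F) l∉F = refl
          open Cover (peel (card X) X ≤-refl
            (≤-trans (card-∈≤length A (λ l e → proj₁ (∈X l e))) A≤s) (λ {l} e → proj₂ (∈X l e)))
          disjoint : ∀ v → v ∈ᵖ blocks → ¬ v ∈ᵖ F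
          disjoint (inj₁ l) l∈ = proj₂ (∈X l (left l∈))
          disjoint (inj₂ r) r∈ = free⇒∉ (proj₁ (right r∈))
          cov : ∀ {l} → l ∈ A → inj₁ l ∈ᵖ (blocks ++ F)
          cov {l} l∈A with inj₁ l ∈ᵖ? F
          ... | yes l∈F = ∈ᵖ-mono (∈-++⁺ʳ blocks) l∈F
          ... | no  l∉F = ∈ᵖ-mono ∈-++⁺ˡ (covers (X∋ l∈A l∉F))

-- Coverer's answers to challenges.

module Challenges (G : BipGraph) where
  open FiniteSums
  open BipGraph G
  open Blocks G
  open import Data.Bool using (true)
  open import Data.Nat using (zero; suc; _+_; _*_; _≤_; z≤n; s≤s)
  open import Data.Nat.Properties using (≤-refl; ≤-reflexive; ≤-trans; +-mono-≤; +-monoˡ-≤; *-monoˡ-≤; +-suc; m≤n+m; m≤n⇒m≤1+n; n≤1+n; module ≤-Reasoning)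
  open import Data.Fin.Properties using (any?)
  open import Data.List using (List; []; _∷_; _++_; concatMap; length; map)
  open import Data.List.Properties using (length-++; length-map)
  open import Data.List.Membership.Propositional using (_∈_; find; lose)
  open import Data.List.Membership.Propositional.Properties using (∈-concatMap⁺; ∈-allFin; ∈-++⁺ˡ; ∈-++⁺ʳ; ∈-map⁺; ∈-filter⁺)
  open import Data.List.Relation.Unary.Any as Any using (Any; here; there)
  open import Data.List.Relation.Unary.All as All using (All; []; _∷_)
  open import Data.List.Relation.Binary.Subset.Propositional using (_⊆_)
  open import Data.Product using (∃-syntax; _×_; _,_; proj₁; proj₂)
  open import Data.Sum using (_⊎_; inj₁; inj₂)
  open import Data.Unit using (⊤; tt)
  open import Data.Empty using (⊥-elim)
  open import Relation.Nullary using (Dec; yes; no; ¬_; ¬?; contradiction; _×-dec_; _⊎-dec_)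
  open import Relation.Nullary.Decidable using (map′; decidable-stable)
  open import Relation.Binary.PropositionalEquality using (_≡_; refl; trans; subst)
  open import Function using (_∘_; id)
  import Data.Bool as Bool

  length-concatMap≤ : ∀ {A B : Set} (f : A → List B) {c} → (∀ x → length (f x) ≤ c) →
                      ∀ xs → length (concatMap f xs) ≤ length xs * c
  length-concatMap≤ f f≤c []       = z≤n
  length-concatMap≤ f f≤c (x ∷ xs) rewrite length-++ (f x) {concatMap f xs} =
    +-mono-≤ (f≤c x) (length-concatMap≤ f f≤c xs)

  nbL : Fin m → List (Fin n)
  nbL l = elements (adj l)

  nbR : Fin n → List (Fin m)
  nbR r = elements (λ l → adj l r)

  ∈-elements : ∀ {k} (X : Fin k → Bool) {i} → X i ≡ true → i ∈ elements X
  ∈-elements X {i} = ∈-filter⁺ (λ j → X j Bool.≟ true) (∈-allFin i)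

  ∈-nbL : ∀ {l r} → l ∼ r → r ∈ nbL l
  ∈-nbL {l} = ∈-elements (adj l)

  ∈-nbR : ∀ {l r} → l ∼ r → l ∈ nbR r
  ∈-nbR {_} {r} = ∈-elements (λ l → adj l r)

  singles : Fin m → List Block
  singles l = concatMap (λ p → map (one l p) (nbL l)) (nbL l)

  -- As terms, `two p l r l′ q` and `two q l′ r l p` differ although they describe the same
  -- component. A block through `l` may occur in an extension in either form, so both are listed.
  doublesTo : Fin m → Fin n → Fin n → Fin m → Fin n → List Block
  doublesTo l p r l′ q = two p l r l′ q ∷ two q l′ r l p ∷ []

  doublesVia : Fin m → Fin n → Fin n → List Block
  doublesVia l p r = concatMap (λ l′ → concatMap (doublesTo l p r l′) (nbL l′)) (nbR r)

  doubles : Fin m → List Block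
  doubles l = concatMap (λ p → concatMap (doublesVia l p) (nbL l)) (nbL l)

  candidates : Fin m → List Block
  candidates l = singles l ++ doubles l

  ∈-doubles : ∀ {l l′ p q r b} → l ∼ p → l ∼ r → l′ ∼ r → l′ ∼ q →
              b ∈ doublesTo l p r l′ q → b ∈ doubles l
  ∈-doubles {l} {l′} {p} {q} {r} l∼p l∼r l′∼r l′∼q b∈ =
    ∈-concatMap⁺ (λ p → concatMap (doublesVia l p) (nbL l)) (lose (∈-nbL l∼p)
      (∈-concatMap⁺ (doublesVia l p) (lose (∈-nbL l∼r)
        (∈-concatMap⁺ (λ l′ → concatMap (doublesTo l p r l′) (nbL l′)) (lose (∈-nbR l′∼r)
          (∈-concatMap⁺ (doublesTo l p r l′) (lose (∈-nbL l′∼q) b∈)))))))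

  ∈-candidates : ∀ {l} b → WellFormed b → inj₁ l ∈ verts b → b ∈ candidates l
  ∈-candidates (iso r) _ (there ())
  ∈-candidates (one l p q) (l∼p , l∼q , _) (here refl) =
    ∈-++⁺ˡ (∈-concatMap⁺ (λ p → map (one l p) (nbL l)) (lose (∈-nbL l∼p) (∈-map⁺ (one l p) (∈-nbL l∼q))))
  ∈-candidates (one l p q) _ (there (there (there ())))
  ∈-candidates (two p l r l′ q) (l∼p , l∼r , l′∼r , l′∼q , _) (here refl) =
    ∈-++⁺ʳ (singles l) (∈-doubles l∼p l∼r l′∼r l′∼q (here refl))
  ∈-candidates (two p l r l′ q) (l∼p , l∼r , l′∼r , l′∼q , _) (there (here refl)) =
    ∈-++⁺ʳ (singles l′) (∈-doubles l′∼q l′∼r l∼r l∼p (there (here refl)))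
  ∈-candidates (two p l r l′ q) _ (there (there (there (there (there ())))))

  Admissible : Fin m → Position → Block → Set
  Admissible l F b = WellFormed b × Fresh b F × inj₁ l ∈ verts b

  admissible? : ∀ l F b → Dec (Admissible l F b)
  admissible? l F b = wellFormed? b ×-dec fresh? b F ×-dec inj₁ l ∈ᵛ? verts b

  -- A decidable reformulation of Extendable: the blocks through the uncovered
  -- elements of A are chosen one after the other.
  Completes : Position → List (Fin m) → Set
  Completes F []      = ⊤
  Completes F (l ∷ A) = (inj₁ l ∈ᵖ F × Completes F A) ⊎
                        Any (λ b → Admissible l F b × Completes (b ∷ F) A) (candidates l)

  completes? : ∀ F A → Dec (Completes F A)
  completes? F []      = yes tt
  completes? F (l ∷ A) = ((inj₁ l ∈ᵖ? F) ×-dec completes? F A) ⊎-dec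
    Any.any? (λ b → admissible? l F b ×-dec completes? (b ∷ F) A) (candidates l)

  valid-admissible : ∀ {l F b} → Valid F → Admissible l F b → Valid (b ∷ F)
  valid-admissible VF (wf-b , fresh , _) = valid-∷ wf-b fresh VF

  completes⇒extendable : ∀ {F} A → Valid F → Completes F A → Extendable F A
  completes⇒extendable {F} [] VF _ = F , id , VF , λ ()
  completes⇒extendable (l ∷ A) VF (inj₁ (l∈F , c)) =
    let F′ , F⊆F′ , VF′ , cov = completes⇒extendable A VF c
    in F′ , F⊆F′ , VF′ , λ { (here refl) → ∈ᵖ-mono F⊆F′ l∈F ; (there i∈A) → cov i∈A }
  completes⇒extendable (l ∷ A) VF (inj₂ any) =
    let b , _ , adm , c = find any
        F′ , bF⊆F′ , VF′ , cov = completes⇒extendable A (valid-admissible VF adm) c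
    in F′ , (bF⊆F′ ∘ there) , VF′ ,
       λ { (here refl) → b , bF⊆F′ (here refl) , proj₂ (proj₂ adm) ; (there i∈A) → cov i∈A }

  -- The block through `l` is read off from `F′`. It is fresh: a block of `F` meeting it would
  -- coincide with it, and then `l` would lie in `F`.
  extendable⇒completes : ∀ {F} A → Extendable F A → Completes F A
  extendable⇒completes [] _ = tt
  extendable⇒completes {F} (l ∷ A) (F′ , F⊆F′ , VF′ , cov) with inj₁ l ∈ᵖ? F
  ... | yes l∈F = inj₁ (l∈F , extendable⇒completes A (F′ , F⊆F′ , VF′ , cov ∘ there))
  ... | no l∉F with b , b∈F′ , l∈b ← cov (here refl) =
    inj₂ (lose (∈-candidates b (wf VF′ b∈F′) l∈b)
      ((wf VF′ b∈F′ , All.tabulate fresh , l∈b) ,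
       extendable⇒completes A (F′ , bF⊆F′ , VF′ , cov ∘ there)))
    where
    fresh : ∀ {v} → v ∈ verts b → ¬ v ∈ᵖ F
    fresh v∈b (b₀ , b₀∈F , v∈b₀) with refl ← coincide VF′ b∈F′ (F⊆F′ b₀∈F) v∈b v∈b₀ =
      l∉F (b , b₀∈F , l∈b)
    bF⊆F′ : b ∷ F ⊆ F′
    bF⊆F′ (here refl) = b∈F′
    bF⊆F′ (there x)   = F⊆F′ x

  extendable? : ∀ {F} → Valid F → ∀ A → Dec (Extendable F A)
  extendable? {F} VF A =
    map′ (completes⇒extendable A VF) (extendable⇒completes A) (completes? F A)

  extendable-anti : ∀ {F A A′} → A′ ⊆ A → Extendable F A → Extendable F A′
  extendable-anti A′⊆A (F′ , F⊆F′ , VF′ , cov) = F′ , F⊆F′ , VF′ , cov ∘ A′⊆A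

  -- The invariant kept by Coverer, with lists in place of sets: dropping repetitions only shortens
  -- a list.
  Good : ℕ → Position → Set
  Good t F = ∀ A → length A ≤ t → Extendable F A

  -- There are finitely many lists of bounded length, and they are searched by recursion on the
  -- bound. This decides constructively whether a candidate preserves the invariant and returns an
  -- offending list if it does not.
  boundedCounterexample? : {P : List (Fin m) → Set} → (∀ A → Dec (P A)) →
                           ∀ t → Dec (∃[ A ] length A ≤ t × ¬ P A)
  boundedCounterexample? {P} P? zero =
    map′ (λ ¬p → [] , z≤n , ¬p) (λ { ([] , _ , ¬p) → ¬p }) (¬? (P? []))
  boundedCounterexample? {P} P? (suc t) =
    map′ (λ { (inj₁ ¬p) → [] , z≤n , ¬p ; (inj₂ (l , A , A≤t , ¬p)) → l ∷ A , s≤s A≤t , ¬p })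
         (λ { ([] , _ , ¬p) → inj₁ ¬p ; (l ∷ A , s≤s A≤t , ¬p) → inj₂ (l , A , A≤t , ¬p) })
         (¬? (P? []) ⊎-dec any? (λ l → boundedCounterexample? (P? ∘ (l ∷_)) t))

  good-or-bad : ∀ {F} t → Valid F → Good t F ⊎ ∃[ A ] length A ≤ t × ¬ Extendable F A
  good-or-bad t VF with boundedCounterexample? (extendable? VF) t
  ... | yes bad = inj₂ bad
  ... | no ¬bad = inj₁ λ A A≤t → decidable-stable (extendable? VF A) (λ ¬e → ¬bad (A , A≤t , ¬e))

  -- An admissible candidate that is not good comes with an offending list of length at most `t`.
  -- The concatenation of these lists offends all of them at once, because a superset of an
  -- offending set is offending.
  good-or-all-bad : ∀ {F} t l → Valid F → ∀ bs →
    Any (λ b → Admissible l F b × Good t (b ∷ F)) bs ⊎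
    ∃[ A ] length A ≤ length bs * t × All (λ b → Admissible l F b → ¬ Extendable (b ∷ F) A) bs
  good-or-all-bad t l VF [] = inj₂ ([] , z≤n , [])
  good-or-all-bad {F} t l VF (b ∷ bs) with good-or-all-bad t l VF bs
  ... | inj₁ any = inj₁ (there any)
  ... | inj₂ (A , A≤ , bad) with admissible? l F b
  ...   | no ¬adm = inj₂ (A , ≤-trans A≤ (*-monoˡ-≤ t (n≤1+n (length bs))) , (λ adm → contradiction adm ¬adm) ∷ bad)
  ...   | yes adm with good-or-bad t (valid-admissible VF adm)
  ...     | inj₁ good = inj₁ (here (adm , good))
  ...     | inj₂ (A′ , A′≤t , ¬ext) = inj₂ (A′ ++ A ,
              ≤-trans (≤-reflexive (length-++ A′)) (+-mono-≤ A′≤t A≤) ,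
              (λ _ → ¬ext ∘ extendable-anti ∈-++⁺ˡ) ∷
              All.map (λ ¬e adm → ¬e adm ∘ extendable-anti (∈-++⁺ʳ A′)) bad)

  -- `c` bounds the number of added blocks; it is tracked because `extend` requires the length of
  -- the position to be at most `k`.
  record Answer (t : ℕ) (F : Position) (c : ℕ) (vs : Vertex G → Set) : Set where
    field
      next     : Position
      extends  : F ⊆ next
      valid    : Valid next
      good     : Good t next
      growth   : length next ≤ c + length F
      covering : ∀ {v} → vs v → v ∈ᵖ next

  module Answering (deg≡3 : ∀ l → degL G l ≡ 3) (s D : ℕ) (degR≤D : ∀ r → degR G r ≤ D)
                   (expansion : ∀ X → card X ≤ s → 39 * card X ≤ 20 * card (nbhd G X)) where
    open Hall deg≡3 s expansion

    length-nbL : ∀ l → length (nbL l) ≡ 3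
    length-nbL l = trans (length-elements (adj l)) (deg≡3 l)

    -- A single block through `l` is given by two neighbours of `l`, which makes 3 · 3 choices. A
    -- double one is given by `p` and `r` (3 choices each), `l′` (at most `D`), `q` (3) and one of
    -- two orientations.
    length-candidates : ∀ l → length (candidates l) ≤ 9 + 54 * D
    length-candidates l = begin
      length (candidates l)                 ≡⟨ length-++ (singles l) ⟩
      length (singles l) + length (doubles l) ≤⟨ +-mono-≤ singles≤ doubles≤ ⟩
      3 * 3 + 3 * (3 * (D * 6))             ≡⟨ rearrange D ⟩
      9 + 54 * D                            ∎
      where
      open ≤-Reasoning
      open import Data.Nat.Solver using (module +-*-Solver)
      open +-*-Solver
      rearrange : ∀ D → 3 * 3 + 3 * (3 * (D * 6)) ≡ 9 + 54 * D
      rearrange = solve 1 (λ D → con 9 :+ con 3 :* (con 3 :* (D :* con 6)) := con 9 :+ con 54 :* D) refl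
      over-nbL : ∀ {B : Set} l {f : Fin n → List B} {c} → (∀ r → length (f r) ≤ c) →
                 length (concatMap f (nbL l)) ≤ 3 * c
      over-nbL l {f} {c} f≤c =
        subst (λ k → length (concatMap f (nbL l)) ≤ k * c) (length-nbL l) (length-concatMap≤ f f≤c (nbL l))
      singles≤ : length (singles l) ≤ 3 * 3
      singles≤ = over-nbL l (λ p → ≤-reflexive (trans (length-map (one l p) (nbL l)) (length-nbL l)))
      doubles≤ : length (doubles l) ≤ 3 * (3 * (D * 6))
      doubles≤ = over-nbL l (λ p → over-nbL l (λ r →
        ≤-trans (length-concatMap≤ _ (λ l′ → over-nbL l′ (λ q → ≤-refl {2})) (nbR r))
                (*-monoˡ-≤ 6 (≤-trans (≤-reflexive (length-elements (λ i → adj i r))) (degR≤D r)))))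

    -- Sets of size `20 * k` must fall under the invariant, and the challenged vertex together with
    -- one offending set for each of `9 + 54 * D` candidates must fit into `s`. Both are assumed
    -- relative to a left vertex: they are derived from `1 ≤ D`, which such a vertex guarantees.
    module _ (t k : ℕ) (sizes : Fin m → 20 * k ≤ t × suc ((9 + 54 * D) * t) ≤ s) where

      -- If no candidate works, `extend` still extends `F` to cover `l` and the collected list `A`.
      -- The block through `l` in that extension is an admissible candidate after which `A` can be
      -- covered, contrary to the choice of `A`.
      answer-left : ∀ {F} → Valid F → Good t F → length F ≤ k → ∀ l → Answer t F 1 (_≡ inj₁ l)
      answer-left {F} VF good F≤k l with inj₁ l ∈ᵖ? F
      ... | yes l∈F = record
        { next = F ; extends = id ; valid = VF ; good = good
        ; growth = m≤n⇒m≤1+n ≤-refl ; covering = λ { refl → l∈F } }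
      ... | no l∉F with good-or-all-bad t l VF (candidates l)
      ...   | inj₁ any = let b , _ , adm , good′ = find any in record
        { next = b ∷ F ; extends = there ; valid = valid-admissible VF adm ; good = good′
        ; growth = ≤-refl ; covering = λ { refl → b , here refl , proj₂ (proj₂ adm) } }
      ...   | inj₂ (A , A≤ , bad) = ⊥-elim (impossible (extendable⇒completes (l ∷ A) extendable))
        where
        extendable : Extendable F (l ∷ A)
        extendable = Over.extend F VF F≤k (λ A′ A′≤ → good A′ (≤-trans A′≤ (proj₁ (sizes l)))) (l ∷ A)
          (≤-trans (s≤s (≤-trans A≤ (*-monoˡ-≤ t (length-candidates l)))) (proj₂ (sizes l)))
        impossible : ¬ Completes F (l ∷ A)
        impossible (inj₁ (l∈F , _)) = l∉F l∈F
        impossible (inj₂ any) = let b , b∈ , adm , c = find any in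
          All.lookup bad b∈ adm (completes⇒extendable A (valid-admissible VF adm) c)

      answer-lefts : ∀ {F} → Valid F → Good t F → ∀ ls → length ls + length F ≤ k →
                     Answer t F (length ls) (λ v → ∃[ l ] l ∈ ls × v ≡ inj₁ l)
      answer-lefts {F} VF good [] _ = record
        { next = F ; extends = id ; valid = VF ; good = good ; growth = ≤-refl
        ; covering = λ () }
      answer-lefts {F} VF good (l ∷ ls) F≤k = record
        { next = A₂.next ; extends = A₂.extends ∘ A₁.extends ; valid = A₂.valid ; good = A₂.good
        ; growth = ≤-trans A₂.growth (shift A₁.growth)
        ; covering = λ { (_ , here refl , refl) → ∈ᵖ-mono A₂.extends (A₁.covering refl)
                       ; (l′ , there l′∈ , refl) → A₂.covering (l′ , l′∈ , refl) } }
        where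
        shift : ∀ {i} → i ≤ 1 + length F → length ls + i ≤ 1 + length ls + length F
        shift {i} i≤ = ≤-trans (+-mono-≤ (≤-refl {length ls}) i≤) (≤-reflexive (+-suc (length ls) (length F)))
        F-small : length F ≤ k
        F-small = ≤-trans (m≤n+m (length F) _) F≤k
        module A₁ = Answer (answer-left VF good F-small l)
        module A₂ = Answer (answer-lefts A₁.valid A₁.good ls (≤-trans (shift A₁.growth) F≤k))

      -- Every left vertex that remains to be covered is non-adjacent to r, so {r} can be
      -- split off as a component of its own.
      isolate : ∀ {F} r → Valid F → Good t F → (∀ {l} → l ∼ r → inj₁ l ∈ᵖ F) → ¬ inj₂ r ∈ᵖ F →
                Good t (iso r ∷ F)
      isolate {F} r VF good nbrs r∉F A A≤t with good A A≤t
      ... | F′ , F⊆F′ , VF′ , cov with inj₂ r ∈ᵖ? F′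
      ...   | no r∉F′ = iso r ∷ F′ , (λ { (here refl) → here refl ; (there x) → there (F⊆F′ x) }) ,
                        valid-∷ tt (r∉F′ ∷ []) VF′ , ∈ᵖ-mono there ∘ cov
      ...   | yes (b , b∈F′ , r∈b) with neighbour b (wf VF′ b∈F′) r∈b
      ...     | inj₁ refl = F′ , (λ { (here refl) → b∈F′ ; (there x) → F⊆F′ x }) , VF′ , cov
      ...     | inj₂ (l , l∈b , l∼r)
        with b₀ , b₀∈F , l∈b₀ ← nbrs l∼r
        with refl ← coincide VF′ b∈F′ (F⊆F′ b₀∈F) l∈b l∈b₀ = ⊥-elim (r∉F (b , b₀∈F , r∈b))

      -- The slack `D` pays for the components added while the neighbours of `r` are covered one by
      -- one. If `r` is uncovered even then, `isolate` applies.
      answer-right : ∀ {F} → Valid F → Good t F → D + length F ≤ k → ∀ r →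
                     ∃[ F′ ] F ⊆ F′ × Valid F′ × Good t F′ × inj₂ r ∈ᵖ F′
      answer-right {F} VF good₀ F≤k r = finish (inj₂ r ∈ᵖ? next)
        where
        nbR≤D : length (nbR r) ≤ D
        nbR≤D = ≤-trans (≤-reflexive (length-elements (λ i → adj i r))) (degR≤D r)
        open Answer (answer-lefts VF good₀ (nbR r) (≤-trans (+-monoˡ-≤ (length F) nbR≤D) F≤k))
        nbrs : ∀ {l} → l ∼ r → inj₁ l ∈ᵖ next
        nbrs {l} l∼r = covering (l , ∈-nbR l∼r , refl)
        finish : Dec (inj₂ r ∈ᵖ next) → ∃[ F′ ] F ⊆ F′ × Valid F′ × Good t F′ × inj₂ r ∈ᵖ F′
        finish (yes r∈) = next , extends , valid , good , r∈
        finish (no r∉)  = iso r ∷ next , there ∘ extends , valid-∷ tt (r∉ ∷ []) valid ,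
                          isolate r valid good nbrs r∉ , iso r , here refl , here refl

      answer : ∀ {F} → Valid F → Good t F → D + length F ≤ k → ∀ v →
               ∃[ F′ ] F ⊆ F′ × Valid F′ × Good t F′ × v ∈ᵖ F′
      answer {F} VF good₀ F≤k (inj₂ r) = answer-right VF good₀ F≤k r
      answer {F} VF good₀ F≤k (inj₁ l) = next , extends , valid , good , covering refl
        where open Answer (answer-left VF good₀ (≤-trans (m≤n+m (length F) D) F≤k) l)

    good-[] : ∀ {t} → t ≤ s → Good t []
    -- The empty position allows `k = 0`, so `small` concerns the empty list alone.
    good-[] t≤s A A≤t = Over.extend [] valid-[] {k = 0} z≤n
      (λ { [] _ → [] , id , valid-[] , λ () }) A (≤-trans A≤t t≤s)

-- From lists of blocks to subgraphs and the game.

module Game (G : BipGraph) where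
  open FiniteSums
  open BipGraph G
  open Blocks G
  open Challenges G
  open import Data.Bool using (true; false)
  open import Data.Nat using (suc; _+_; _*_; _≤_; _/_; z≤n; s≤s)
  open import Data.Nat.Properties using (≤-refl; ≤-reflexive; ≤-trans; n≤1+n; +-comm; +-mono-≤; +-monoˡ-≤; *-comm; *-mono-≤; module ≤-Reasoning)
  open import Data.Nat.DivMod using (m/n≤m; m/n*n≤m; m*n/n≡m; /-monoˡ-≤)
  open import Data.Fin using (_≟_)
  open import Data.List using (List; []; _∷_; allFin; length; filter)
  open import Data.List.Membership.Propositional using (_∈_; find; lose)
  open import Data.List.Membership.Propositional.Properties using (∈-filter⁺; ∈-filter⁻)
  open import Data.List.Relation.Unary.Any as Any using (Any; here; there)
  open import Data.List.Relation.Unary.All as All using (All; []; _∷_)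
  open import Data.List.Relation.Unary.Unique.Propositional using (Unique; []; _∷_)
  open import Data.List.Relation.Binary.Subset.Propositional using (_⊆_)
  open import Data.Product using (Σ; ∃-syntax; _×_; _,_; proj₁; proj₂)
  open import Data.Product.Properties using () renaming (≡-dec to ×-≡-dec)
  open import Data.Sum using (_⊎_; inj₁; inj₂)
  open import Data.Empty using (⊥; ⊥-elim)
  open import Relation.Nullary using (Dec; does; yes; no; ¬_; ¬?; contradiction)
  open import Relation.Nullary.Decidable using (dec-true; map′)
  open import Relation.Binary.PropositionalEquality using (_≡_; _≢_; refl; sym; trans; cong; cong₂; subst)
  open import Function using (_∘_; _⇔_; mk⇔; module Equivalence)
  import Data.List.Membership.DecPropositional as DecMembership
  import Data.Rational as ℚ

  open Equivalence using (to; from)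

  edges : Block → List (Fin m × Fin n)
  edges (iso r)          = []
  edges (one l p q)      = (l , p) ∷ (l , q) ∷ []
  edges (two p l r l′ q) = (l , p) ∷ (l , r) ∷ (l′ , r) ∷ (l′ , q) ∷ []

  length-edges : ∀ b → length (edges b) ≤ 4
  length-edges (iso r)          = z≤n
  length-edges (one l p q)      = s≤s (s≤s z≤n)
  length-edges (two p l r l′ q) = ≤-refl

  edge-ends : ∀ b {l r} → (l , r) ∈ edges b → inj₁ l ∈ verts b × inj₂ r ∈ verts b
  edge-ends (one l p q) (here refl) = here refl , there (here refl)
  edge-ends (one l p q) (there (here refl)) = here refl , there (there (here refl))
  edge-ends (two p l r l′ q) (here refl) = here refl , there (there (there (here refl)))
  edge-ends (two p l r l′ q) (there (here refl)) = here refl , there (there (here refl))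
  edge-ends (two p l r l′ q) (there (there (here refl))) = there (here refl) , there (there (here refl))
  edge-ends (two p l r l′ q) (there (there (there (here refl)))) =
    there (here refl) , there (there (there (there (here refl))))

  edge-adj : ∀ b {l r} → WellFormed b → (l , r) ∈ edges b → l ∼ r
  edge-adj (one l p q) (l∼p , _) (here refl) = l∼p
  edge-adj (one l p q) (_ , l∼q , _) (there (here refl)) = l∼q
  edge-adj (two p l r l′ q) (l∼p , _) (here refl) = l∼p
  edge-adj (two p l r l′ q) (_ , l∼r , _) (there (here refl)) = l∼r
  edge-adj (two p l r l′ q) (_ , _ , l′∼r , _) (there (there (here refl))) = l′∼r
  edge-adj (two p l r l′ q) (_ , _ , _ , l′∼q , _) (there (there (there (here refl)))) = l′∼q

  two-edges : ∀ b {l} → WellFormed b → inj₁ l ∈ verts b →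
              ∃[ p ] ∃[ q ] p ≢ q × (l , p) ∈ edges b × (l , q) ∈ edges b ×
                            (∀ {r} → (l , r) ∈ edges b → r ≡ p ⊎ r ≡ q)
  two-edges (iso r) _ (there ())
  two-edges (one l p q) (_ , _ , p≢q) (here refl) = p , q , p≢q , here refl , there (here refl) ,
    λ { (here refl) → inj₁ refl ; (there (here refl)) → inj₂ refl }
  two-edges (one l p q) _ (there (there (there ())))
  two-edges (two p l r l′ q) (_ , _ , _ , _ , l≢l′ , p≢r , _) (here refl) =
    p , r , p≢r , here refl , there (here refl) ,
    λ { (here refl) → inj₁ refl ; (there (here refl)) → inj₂ refl
      ; (there (there (here refl))) → ⊥-elim (l≢l′ refl)
      ; (there (there (there (here refl)))) → ⊥-elim (l≢l′ refl) }
  two-edges (two p l r l′ q) (_ , _ , _ , _ , l≢l′ , _ , r≢q , _) (there (here refl)) =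
    r , q , r≢q , there (there (here refl)) , there (there (there (here refl))) ,
    λ { (here refl) → ⊥-elim (l≢l′ refl) ; (there (here refl)) → ⊥-elim (l≢l′ refl)
      ; (there (there (here refl))) → inj₁ refl
      ; (there (there (there (here refl)))) → inj₂ refl }
  two-edges (two p l r l′ q) _ (there (there (there (there (there ())))))

  infix 4 _∈ᵉ_
  _∈ᵉ_ : Fin m × Fin n → Position → Set
  e ∈ᵉ F = ∃[ b ] b ∈ F × e ∈ edges b

  _∈ᵉ?_ : ∀ e F → Dec (e ∈ᵉ F)
  e ∈ᵉ? F = map′ find (λ (b , b∈F , e∈b) → lose b∈F e∈b) (Any.any? (λ b → e ∈? edges b) F)
    where open DecMembership (×-≡-dec (_≟_ {m}) (_≟_ {n})) using (_∈?_)

  -- `RemoveComponent` describes the new subgraph only pointwise, and a list of blocks may repeat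
  -- entries, so positions and subgraphs are linked by a relation.
  record Represents (F : Position) (P : Subgraph G) : Set where
    field
      vertices : ∀ v → V P v ≡ true ⇔ v ∈ᵖ F
      edgesOf  : ∀ l r → E P l r ≡ true ⇔ (l , r) ∈ᵉ F
  open Represents

  does⇔ : ∀ {P : Set} (P? : Dec P) → does P? ≡ true ⇔ P
  does⇔ P? = mk⇔ (out P?) (dec-true P?)
    where
    out : ∀ {P : Set} (P? : Dec P) → does P? ≡ true → P
    out (yes p) _ = p

  subgraph : (F : Position) → Valid F → Subgraph G
  subgraph F VF = record
    { V    = λ v → does (v ∈ᵖ? F)
    ; E    = λ l r → does ((l , r) ∈ᵉ? F)
    ; E⊆G  = λ l r e → let b , b∈F , e∈b = to (does⇔ ((l , r) ∈ᵉ? F)) e in edge-adj b (wf VF b∈F) e∈b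
    ; E→Vl = λ l r e → let b , b∈F , e∈b = to (does⇔ ((l , r) ∈ᵉ? F)) e
                       in from (does⇔ (inj₁ l ∈ᵖ? F)) (b , b∈F , proj₁ (edge-ends b e∈b))
    ; E→Vr = λ l r e → let b , b∈F , e∈b = to (does⇔ ((l , r) ∈ᵉ? F)) e
                       in from (does⇔ (inj₂ r ∈ᵖ? F)) (b , b∈F , proj₂ (edge-ends b e∈b)) }

  represents-subgraph : ∀ F VF → Represents F (subgraph F VF)
  represents-subgraph F VF = record
    { vertices = λ v → does⇔ (v ∈ᵖ? F) ; edgesOf = λ l r → does⇔ ((l , r) ∈ᵉ? F) }

  -- Reachability and cycles in a subgraph.

  module _ (P : Subgraph G) where

    adj-sym : ∀ v w → AdjF G P v w → AdjF G P w v
    adj-sym (inj₁ l) (inj₂ r) e = e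
    adj-sym (inj₂ r) (inj₁ l) e = e

    adj-source : ∀ v w → AdjF G P v w → V P v ≡ true
    adj-source (inj₁ l) (inj₂ r) e = E→Vl P l r e
    adj-source (inj₂ r) (inj₁ l) e = E→Vr P l r e

    reach-source : ∀ {v w} → Reach G P v w → V P v ≡ true
    reach-source (here v∈)  = v∈
    reach-source (step p _) = reach-source p

    reach-trans : ∀ {u v w} → Reach G P u v → Reach G P v w → Reach G P u w
    reach-trans p (here _)   = p
    reach-trans p (step q e) = step (reach-trans p q) e

    adj-reach : ∀ v w → AdjF G P v w → Reach G P v w
    adj-reach v w e = step (here (adj-source v w e)) e

    reach-sym : ∀ {v w} → Reach G P v w → Reach G P w v
    reach-sym (here v∈) = here v∈
    reach-sym (step {w} {x} p e) = reach-trans (adj-reach x w (adj-sym w x e)) (reach-sym p)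

    -- This property of its vertices is all that the proof of `acyclic` uses about a cycle.
    TwoNeighboursIn : List (Vertex G) → Vertex G → Set
    TwoNeighboursIn cs v =
      ∃[ x ] ∃[ y ] x ≢ y × x ∈ cs × y ∈ cs × AdjF G P v x × AdjF G P v y

    cycle-end : ∀ {first} u us → CyclicallyAdjacent G P first (u ∷ us) →
                ∃[ z ] z ∈ u ∷ us × AdjF G P z first
    cycle-end u []       e       = u , here refl , e
    cycle-end u (w ∷ us) (_ , c) = let z , z∈ , e = cycle-end w us c in z , there z∈ , e

    -- p is the predecessor of u; the condition on us handles the case where the
    -- successor of u is the starting vertex of the cycle.
    cycle-interior : ∀ {first cs} p u us → AdjF G P p u → CyclicallyAdjacent G P first (u ∷ us) →
      All (p ≢_) us → (us ≡ [] → p ≢ first) → Unique (u ∷ us) → All (first ≢_) (u ∷ us) →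
      first ∈ cs → p ∈ cs → u ∷ us ⊆ cs → ∀ {x} → x ∈ u ∷ us → TwoNeighboursIn cs x
    cycle-interior {first} p u [] pu c _ p≢ _ _ first∈ p∈ ⊆cs (here refl) =
      p , first , p≢ refl , p∈ , first∈ , adj-sym p u pu , c
    cycle-interior p u (w ∷ us) pu (uw , _) (p≢w ∷ _) _ _ _ first∈ p∈ ⊆cs (here refl) =
      p , w , p≢w , p∈ , ⊆cs (there (here refl)) , adj-sym p u pu , uw
    cycle-interior p u (w ∷ us) _ (uw , c) _ _ ((_ ∷ u∉us) ∷ uniq) (first≢u ∷ first∉) first∈ p∈ ⊆cs (there x∈) =
      cycle-interior u w us uw c u∉us (λ _ → first≢u ∘ sym) uniq first∉ first∈
        (⊆cs (here refl)) (⊆cs ∘ there) x∈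

    -- The start of the cycle is adjacent to the second and to the last vertex, which differ because
    -- there are at least three distinct vertices. The other vertices fall to `cycle-interior`.
    cycle-neighbours : ∀ cs → IsCycle G P cs → ∀ {x} → x ∈ cs → TwoNeighboursIn cs x
    cycle-neighbours (v ∷ []) (_ , s≤s () , _)
    cycle-neighbours (v ∷ w ∷ []) (_ , s≤s (s≤s ()) , _)
    cycle-neighbours (v ∷ w ∷ u ∷ us) (_ ∷ w∉ ∷ _ , _ , vw , _ , c) (here refl) =
      let z , z∈ , zv = cycle-end u us c
      in w , z , All.lookup w∉ z∈ , there (here refl) , there (there z∈) , vw , adj-sym z v zv
    cycle-neighbours (v ∷ w ∷ u ∷ us) ((v≢w ∷ v∉) ∷ uniq , _ , vw , c) (there x∈) =
      cycle-interior v w (u ∷ us) vw c v∉ (λ ()) uniq (v≢w ∷ v∉) (here refl) (here refl) there x∈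

  -- Blocks as the connected components of a represented subgraph.

  module Component {F : Position} {P : Subgraph G} (VF : Valid F) (rep : Represents F P) where

    -- Adjacency inside one block, so that the neighbours of a vertex can be found by matching on an
    -- explicit list of edges.
    BlockAdj : Block → Vertex G → Vertex G → Set
    BlockAdj b (inj₁ l) (inj₂ r) = (l , r) ∈ edges b
    BlockAdj b (inj₂ r) (inj₁ l) = (l , r) ∈ edges b
    BlockAdj b (inj₁ _) (inj₁ _) = ⊥
    BlockAdj b (inj₂ _) (inj₂ _) = ⊥

    blockAdj-ends : ∀ b v w → BlockAdj b v w → v ∈ verts b × w ∈ verts b
    blockAdj-ends b (inj₁ l) (inj₂ r) e = edge-ends b e
    blockAdj-ends b (inj₂ r) (inj₁ l) e = proj₂ (edge-ends b e) , proj₁ (edge-ends b e)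

    -- The edge belongs to some block, and that block shares `v` with `b`, so `coincide` identifies
    -- the two.
    adj⇒blockAdj : ∀ {b} v w → b ∈ F → v ∈ verts b → AdjF G P v w → BlockAdj b v w
    adj⇒blockAdj (inj₁ l) (inj₂ r) b∈F v∈b e
      with b′ , b′∈F , e∈b′ ← to (edgesOf rep l r) e
      with refl ← coincide VF b∈F b′∈F v∈b (proj₁ (edge-ends b′ e∈b′)) = e∈b′
    adj⇒blockAdj (inj₂ r) (inj₁ l) b∈F v∈b e
      with b′ , b′∈F , e∈b′ ← to (edgesOf rep l r) e
      with refl ← coincide VF b∈F b′∈F v∈b (proj₂ (edge-ends b′ e∈b′)) = e∈b′

    -- No edge leaves a block. Together with `reach-block` this makes the vertex sets of the blocks
    -- the connected components.
    reach-inside : ∀ {b v w} → b ∈ F → v ∈ verts b → Reach G P v w → w ∈ verts b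
    reach-inside b∈F v∈b (here _) = v∈b
    reach-inside {b} b∈F v∈b (step {u} {w} p e) =
      proj₂ (blockAdj-ends b u w (adj⇒blockAdj u w b∈F (reach-inside b∈F v∈b p) e))

    -- Both vertices are reached from a central vertex of the block, which is the left vertex of
    -- `one` and the middle vertex of `two`.
    reach-block : ∀ {b v w} → b ∈ F → v ∈ verts b → w ∈ verts b → Reach G P v w
    reach-block {b} b∈F v∈b w∈b =
      reach-trans P (reach-sym P (from-hub b b∈F v∈b)) (from-hub b b∈F w∈b)
      where
      hub : Block → Vertex G
      hub (iso r)          = inj₂ r
      hub (one l p q)      = inj₁ l
      hub (two p l r l′ q) = inj₂ r
      edge : ∀ {b l r} → b ∈ F → (l , r) ∈ edges b → E P l r ≡ true
      edge b∈F e = from (edgesOf rep _ _) (_ , b∈F , e)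
      start : ∀ {b v} → b ∈ F → v ∈ verts b → Reach G P v v
      start b∈F v∈b = here (from (vertices rep _) (_ , b∈F , v∈b))
      from-hub : ∀ b {v} → b ∈ F → v ∈ verts b → Reach G P (hub b) v
      from-hub (iso r) b∈F (here refl) = start b∈F (here refl)
      from-hub (one l p q) b∈F (here refl) = start b∈F (here refl)
      from-hub (one l p q) b∈F (there (here refl)) = step (start b∈F (here refl)) (edge b∈F (here refl))
      from-hub (one l p q) b∈F (there (there (here refl))) =
        step (start b∈F (here refl)) (edge b∈F (there (here refl)))
      from-hub (two p l r l′ q) b∈F (here refl) =
        step (start b∈F (there (there (here refl)))) (edge b∈F (there (here refl)))
      from-hub (two p l r l′ q) b∈F (there (here refl)) =
        step (start b∈F (there (there (here refl)))) (edge b∈F (there (there (here refl))))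
      from-hub (two p l r l′ q) b∈F (there (there (here refl))) = start b∈F (there (there (here refl)))
      from-hub (two p l r l′ q) b∈F (there (there (there (here refl)))) =
        step (from-hub (two p l r l′ q) b∈F (here refl)) (edge b∈F (here refl))
      from-hub (two p l r l′ q) b∈F (there (there (there (there (here refl))))) =
        step (from-hub (two p l r l′ q) b∈F (there (here refl))) (edge b∈F (there (there (there (here refl)))))

    -- Leaves have a single neighbour, so they lie on no cycle; pruning them leaves
    -- vertices with at most one neighbour.
    acyclic : Acyclic G P
    acyclic [] ()
    acyclic (v ∷ vs) cyc = no-vertex (to (vertices rep v) v∈V) (here refl)
      where
      cs = v ∷ vs
      nbrs : ∀ {x} → x ∈ cs → TwoNeighboursIn P cs x
      nbrs = cycle-neighbours P cs cyc
      v∈V : V P v ≡ true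
      v∈V = let x , _ , _ , _ , _ , vx , _ = nbrs (here refl) in adj-source P v x vx
      module _ {b} (b∈F : b ∈ F) where
        inner : ∀ {x} → x ∈ verts b → x ∈ cs →
                ∃[ y ] ∃[ z ] y ≢ z × y ∈ cs × z ∈ cs × BlockAdj b x y × BlockAdj b x z
        inner {x} x∈b x∈cs = let y , z , y≢z , y∈ , z∈ , xy , xz = nbrs x∈cs in
          y , z , y≢z , y∈ , z∈ , adj⇒blockAdj x y b∈F x∈b xy , adj⇒blockAdj x z b∈F x∈b xz
        leaf : ∀ {x a} → x ∈ verts b → (∀ y → BlockAdj b x y → y ≡ a) → ¬ x ∈ cs
        leaf x∈b only x∈cs = let y , z , y≢z , _ , _ , xy , xz = inner x∈b x∈cs in
          y≢z (trans (only y xy) (sym (only z xz)))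
        twig : ∀ {x a c} → x ∈ verts b → (∀ y → BlockAdj b x y → y ≡ a ⊎ y ≡ c) → ¬ a ∈ cs → ¬ x ∈ cs
        twig x∈b only a∉cs x∈cs with inner x∈b x∈cs
        ... | y , z , y≢z , y∈ , z∈ , xy , xz with only y xy | only z xz
        ...   | inj₁ refl | _         = a∉cs y∈
        ...   | inj₂ _    | inj₁ refl = a∉cs z∈
        ...   | inj₂ refl | inj₂ refl = y≢z refl

      block-vertex : ∀ b → b ∈ F → ∀ {x} → x ∈ verts b → ¬ x ∈ cs
      block-vertex (iso r) b∈F (here refl) r∈cs with inner b∈F (here refl) r∈cs
      ... | inj₁ _ , _ , _ , _ , _ , () , _
      block-vertex (one l p q) b∈F = case
        where
        only-l : ∀ r y → BlockAdj (one l p q) (inj₂ r) y → y ≡ inj₁ l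
        only-l _ (inj₁ _) (here refl) = refl
        only-l _ (inj₁ _) (there (here refl)) = refl
        p∉ = leaf b∈F (there (here refl)) (only-l p)
        q∉ = leaf b∈F (there (there (here refl))) (only-l q)
        pq : ∀ y → BlockAdj (one l p q) (inj₁ l) y → y ≡ inj₂ p ⊎ y ≡ inj₂ q
        pq (inj₂ _) (here refl) = inj₁ refl
        pq (inj₂ _) (there (here refl)) = inj₂ refl
        case : ∀ {x} → x ∈ verts (one l p q) → ¬ x ∈ cs
        case (here refl) = twig b∈F (here refl) pq p∉
        case (there (here refl)) = p∉
        case (there (there (here refl))) = q∉
      block-vertex b@(two p l r l′ q) b∈F with wf VF b∈F
      ... | _ , _ , _ , _ , l≢l′ , p≢r , r≢q , p≢q = case
        where
        only-l : ∀ y → BlockAdj b (inj₂ p) y → y ≡ inj₁ l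
        only-l (inj₁ _) (here refl) = refl
        only-l (inj₁ _) (there (here refl)) = ⊥-elim (p≢r refl)
        only-l (inj₁ _) (there (there (here refl))) = ⊥-elim (p≢r refl)
        only-l (inj₁ _) (there (there (there (here refl)))) = ⊥-elim (p≢q refl)
        only-l′ : ∀ y → BlockAdj b (inj₂ q) y → y ≡ inj₁ l′
        only-l′ (inj₁ _) (here refl) = ⊥-elim (p≢q refl)
        only-l′ (inj₁ _) (there (here refl)) = ⊥-elim (r≢q refl)
        only-l′ (inj₁ _) (there (there (here refl))) = refl
        only-l′ (inj₁ _) (there (there (there (here refl)))) = refl
        pr : ∀ y → BlockAdj b (inj₁ l) y → y ≡ inj₂ p ⊎ y ≡ inj₂ r
        pr (inj₂ _) (here refl) = inj₁ refl
        pr (inj₂ _) (there (here refl)) = inj₂ refl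
        pr (inj₂ _) (there (there (here refl))) = ⊥-elim (l≢l′ refl)
        pr (inj₂ _) (there (there (there (here refl)))) = ⊥-elim (l≢l′ refl)
        qr : ∀ y → BlockAdj b (inj₁ l′) y → y ≡ inj₂ q ⊎ y ≡ inj₂ r
        qr (inj₂ _) (here refl) = ⊥-elim (l≢l′ refl)
        qr (inj₂ _) (there (here refl)) = ⊥-elim (l≢l′ refl)
        qr (inj₂ _) (there (there (here refl))) = inj₂ refl
        qr (inj₂ _) (there (there (there (here refl)))) = inj₁ refl
        ll′ : ∀ y → BlockAdj b (inj₂ r) y → y ≡ inj₁ l ⊎ y ≡ inj₁ l′
        ll′ (inj₁ _) (here refl) = inj₁ refl
        ll′ (inj₁ _) (there (here refl)) = inj₁ refl
        ll′ (inj₁ _) (there (there (here refl))) = inj₂ refl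
        ll′ (inj₁ _) (there (there (there (here refl)))) = inj₂ refl
        -- The path is pruned from its ends: `p` and `q` are leaves; without them `l` and `l′`
        -- retain only `r`; without `l` the vertex `r` retains only `l′`.
        p∉  = leaf b∈F (there (there (there (here refl)))) only-l
        q∉  = leaf b∈F (there (there (there (there (here refl))))) only-l′
        l∉  = twig b∈F (here refl) pr p∉
        case : ∀ {x} → x ∈ verts b → ¬ x ∈ cs
        case (here refl) = l∉
        case (there (here refl)) = twig b∈F (there (here refl)) qr q∉
        case (there (there (here refl))) = twig b∈F (there (there (here refl))) ll′ l∉
        case (there (there (there (here refl)))) = p∉
        case (there (there (there (there (here refl))))) = q∉

      no-vertex : ∀ {x} → x ∈ᵖ F → ¬ x ∈ cs
      no-vertex (b , b∈F , x∈b) = block-vertex b b∈F x∈b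

    -- The indicator of the neighbourhood of `l` is the sum of the point masses at the two distinct
    -- neighbours that `l` has in its block.
    left-degree : ∀ l → V P (inj₁ l) ≡ true → card (E P l) ≡ 2
    left-degree l l∈V
      with b , b∈F , l∈b ← to (vertices rep (inj₁ l)) l∈V
      with p , q , p≢q , lp , lq , only ← two-edges b (wf VF b∈F) l∈b
      = trans (sumOver-cong (allFin n) count)
          (trans (sumOver-+ (allFin n) (δ p 1) (δ q 1)) (cong₂ _+_ (∑-δ p 1) (∑-δ q 1)))
      where
      inside : ∀ {r} → E P l r ≡ true → r ≡ p ⊎ r ≡ q
      inside {r} e = only (adj⇒blockAdj (inj₁ l) (inj₂ r) b∈F l∈b e)
      edge : ∀ {r} → (l , r) ∈ edges b → E P l r ≡ true
      edge e = from (edgesOf rep l _) (b , b∈F , e)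
      count : ∀ r → ⟦ E P l r ⟧ ≡ δ p 1 r + δ q 1 r
      count r with r ≟ p | r ≟ q
      ... | yes refl | yes refl = ⊥-elim (p≢q refl)
      ... | yes refl | no _     rewrite edge lp = refl
      ... | no _     | yes refl rewrite edge lq = refl
      ... | no r≢p   | no r≢q with E P l r in e
      ...   | false = refl
      ...   | true with inside e
      ...     | inj₁ r≡p = contradiction r≡p r≢p
      ...     | inj₂ r≡q = contradiction r≡q r≢q

    is24Matching : Is24Matching G P
    is24Matching = acyclic , small , left-degree
      where
      small : ∀ v → V P v ≡ true → ComponentEdgesAtMost G P v 4
      small v v∈V = let b , b∈F , v∈b = to (vertices rep v) v∈V in
        edges b , length-edges b , λ l r e reach →
          adj⇒blockAdj (inj₁ l) (inj₂ r) b∈F (reach-inside b∈F v∈b reach) e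

    module Removal (v : Vertex G) {P′ : Subgraph G} (removed : RemoveComponent G P v P′) where

      avoids? : ∀ b → Dec (¬ v ∈ verts b)
      avoids? b = ¬? (v ∈ᵛ? verts b)

      -- Every entry of the list that contains `v` goes; by `coincide` these are copies of a single
      -- block.
      rest : Position
      rest = filter avoids? F

      rest⊆F : rest ⊆ F
      rest⊆F b∈ = proj₁ (∈-filter⁻ avoids? b∈)

      valid-rest : Valid rest
      valid-rest = record
        { wf = wf VF ∘ rest⊆F ; coincide = λ b∈ b′∈ → coincide VF (rest⊆F b∈) (rest⊆F b′∈) }

      in-rest : ∀ {b w} → b ∈ F → w ∈ verts b → ¬ Reach G P v w → b ∈ rest
      in-rest b∈F w∈b ¬reach =
        ∈-filter⁺ avoids? b∈F (λ v∈b → ¬reach (reach-block b∈F v∈b w∈b))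

      unreached : ∀ {b w} → b ∈ rest → w ∈ verts b → ¬ Reach G P v w
      unreached b∈ w∈b reach with b∈F , v∉b ← ∈-filter⁻ avoids? b∈
        = v∉b (reach-inside b∈F w∈b (reach-sym P reach))

      represents-rest : Represents rest P′
      represents-rest = record
        { vertices = λ w → mk⇔
            (λ e → let w∈V , ¬reach = to (proj₁ removed w) e
                       b , b∈F , w∈b = to (vertices rep w) w∈V
                   in b , in-rest b∈F w∈b ¬reach , w∈b)
            (λ (b , b∈ , w∈b) → from (proj₁ removed w)
              (from (vertices rep w) (b , rest⊆F b∈ , w∈b) , unreached b∈ w∈b))
        ; edgesOf = λ l r → mk⇔
            (λ e → let e∈E , ¬reach = to (proj₂ removed l r) e
                       b , b∈F , e∈b = to (edgesOf rep l r) e∈E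
                   in b , in-rest b∈F (proj₁ (edge-ends b e∈b)) ¬reach , e∈b)
            (λ (b , b∈ , e∈b) → from (proj₂ removed l r)
              (from (edgesOf rep l r) (b , rest⊆F b∈ , e∈b) , unreached b∈ (proj₁ (edge-ends b e∈b)))) }

    -- Listing one block per representative bounds the number of blocks by the number of components.
    selected : List (Vertex G) → Position
    selected []       = []
    selected (w ∷ ws) with w ∈ᵖ? F
    ... | yes (b , _) = b ∷ selected ws
    ... | no  _       = selected ws

    length-selected : ∀ ws → length (selected ws) ≤ length ws
    length-selected []       = z≤n
    length-selected (w ∷ ws) with w ∈ᵖ? F
    ... | yes _ = s≤s (length-selected ws)
    ... | no  _ = ≤-trans (length-selected ws) (n≤1+n _)

    selected⊆F : ∀ ws → selected ws ⊆ F
    selected⊆F (w ∷ ws) x with w ∈ᵖ? F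
    selected⊆F (w ∷ ws) (here refl) | yes (b , b∈F , _) = b∈F
    selected⊆F (w ∷ ws) (there x)   | yes _ = selected⊆F ws x
    selected⊆F (w ∷ ws) x           | no _ = selected⊆F ws x

    ∈-selected : ∀ {ws w b} → w ∈ ws → b ∈ F → w ∈ verts b → b ∈ selected ws
    ∈-selected {w ∷ ws} (here refl) b∈F w∈b with w ∈ᵖ? F
    ... | yes (b′ , b′∈F , w∈b′) = here (coincide VF b∈F b′∈F w∈b w∈b′)
    ... | no  w∉F = ⊥-elim (w∉F (_ , b∈F , w∈b))
    ∈-selected {w ∷ ws} (there w∈) b∈F w∈b with w ∈ᵖ? F
    ... | yes _ = there (∈-selected w∈ b∈F w∈b)
    ... | no  _ = ∈-selected w∈ b∈F w∈b

    -- A representative that reaches a vertex of `b` lies in `b`, so `b` is the block selected for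
    -- it.
    F⊆selected : ∀ {ws} → (∀ u → V P u ≡ true → Σ (Vertex G) λ w → (w ∈ ws) × Reach G P w u) →
                 F ⊆ selected ws
    F⊆selected reps {b} b∈F =
      let u , u∈b = vertex b
          w , w∈ws , reach = reps u (from (vertices rep u) (b , b∈F , u∈b))
      in ∈-selected w∈ws b∈F (reach-inside b∈F u∈b (reach-sym P reach))
      where
      vertex : ∀ b → ∃[ u ] u ∈ verts b
      vertex (iso r)          = _ , here refl
      vertex (one l p q)      = _ , here refl
      vertex (two p l r l′ q) = _ , here refl

  -- For `v` in a block `b` of `F`, the component of `v` is `b` in both subgraphs, because `b` is a
  -- block of `F′` as well.
  keeps : ∀ {F F′ P P′} → Valid F → Valid F′ → Represents F P → Represents F′ P′ → F ⊆ F′ →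
          KeepsComponents G P P′
  keeps VF VF′ rep rep′ F⊆F′ v v∈V with b , b∈F , v∈b ← to (vertices rep v) v∈V =
    (λ u → mk⇔ (λ reach → C.reach-block b∈F v∈b (C′.reach-inside (F⊆F′ b∈F) v∈b reach))
               (λ reach → C′.reach-block (F⊆F′ b∈F) v∈b (C.reach-inside b∈F v∈b reach))) ,
    (λ l r reach → let l∈b = C.reach-inside b∈F v∈b reach in
      mk⇔ (λ e → from (edgesOf rep l r) (b , b∈F , C′.adj⇒blockAdj (inj₁ l) (inj₂ r) (F⊆F′ b∈F) l∈b e))
          (λ e → from (edgesOf rep′ l r) (b , F⊆F′ b∈F , C.adj⇒blockAdj (inj₁ l) (inj₂ r) b∈F l∈b e)))
    where
    module C  = Component VF rep
    module C′ = Component VF′ rep′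

  -- Coverer's winning set of positions.

  module Winning (deg≡3 : ∀ l → degL G l ≡ 3) (s D : ℕ) (degR≤D : ∀ r → degR G r ≤ D)
                 (expansion : ∀ X → card X ≤ s → 39 * card X ≤ 20 * card (nbhd G X)) (μ : ℚ.ℚ)
                 (sizes : ∀ k → ℕ→ℚ k ℚ.< μ → 1 ≤ D → (10 + 54 * D) * (20 * (k + D)) ≤ s) where
    open Answering deg≡3 s D degR≤D expansion

    -- There are at most `9 + 54 * D` candidates, hence at most as many offending sets of size at
    -- most `t`; one further summand `t` makes room for the challenged vertex as soon as `1 ≤ t`.
    t : ℕ
    t = s / (10 + 54 * D)

    Winning : Subgraph G → Set
    Winning P = ∃[ F ] Valid F × Represents F P × Good t F

    -- `l` has three neighbours, and the degree of any of them is positive because of `l`.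
    D≥1 : Fin m → 1 ≤ D
    D≥1 l with nbL l in eq
    ... | [] with () ← trans (sym (cong length eq)) (length-nbL l)
    ... | r ∷ _ = ≤-trans (subst (1 ≤_) (length-elements (λ i → adj i r)) (nonempty (∈-nbR {l} {r} l∼r))) (degR≤D r)
      where
      l∼r : l ∼ r
      l∼r = proj₂ (∈-filter⁻ (λ j → adj l j Data.Bool.≟ true) {xs = allFin n} (subst (r ∈_) (sym eq) (here refl)))
      nonempty : ∀ {A : Set} {x : A} {xs} → x ∈ xs → 1 ≤ length xs
      nonempty (here _)  = s≤s z≤n
      nonempty (there _) = s≤s z≤n

    sizes′ : ∀ k → ℕ→ℚ k ℚ.< μ → Fin m →
             20 * (k + D) ≤ t × suc ((9 + 54 * D) * t) ≤ s
    sizes′ k k<μ l = 20K≤t , ≤-trans (+-monoˡ-≤ ((9 + 54 * D) * t) 1≤t) (≤-trans (≤-reflexive (*-comm (10 + 54 * D) t)) (m/n*n≤m s (10 + 54 * D)))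
      where
      open ≤-Reasoning
      20K≤t : 20 * (k + D) ≤ t
      20K≤t = begin
        20 * (k + D)                                     ≡⟨ sym (m*n/n≡m (20 * (k + D)) (10 + 54 * D)) ⟩
        20 * (k + D) * (10 + 54 * D) / (10 + 54 * D)     ≤⟨ /-monoˡ-≤ (10 + 54 * D) (≤-trans (≤-reflexive (*-comm (20 * (k + D)) (10 + 54 * D))) (sizes k k<μ (D≥1 l))) ⟩
        t                                                ∎
      1≤t : 1 ≤ t
      1≤t = ≤-trans (*-mono-≤ (s≤s (z≤n {19})) (+-mono-≤ (z≤n {k}) (D≥1 l))) 20K≤t

    covererWins : CovererWins G μ
    covererWins = Winning ,
      ([] , valid-[] , empty , good-[] (m/n≤m s (10 + 54 * D))) ,
      (λ _ (_ , VF , rep , _) → Component.is24Matching VF rep) ,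
      (λ { P v P′ (F , VF , rep , good) _ removed →
         let open Component.Removal VF rep v removed in
         -- An extension of `F` also extends the smaller list `rest`, so the invariant survives the
         -- removal.
         rest , valid-rest , represents-rest , λ A A≤t →
           let F′ , F⊆F′ , rest-of = good A A≤t in F′ , F⊆F′ ∘ rest⊆F , rest-of }) ,
      respond
      where
      empty : Represents [] (emptySubgraph G)
      empty = record { vertices = λ _ → mk⇔ (λ ()) (λ ()) ; edgesOf = λ _ _ → mk⇔ (λ ()) (λ ()) }
      respond : ∀ P → Winning P → FewerComponentsThan G P μ → ∀ v →
                Σ (Subgraph G) λ P′ → Winning P′ × KeepsComponents G P P′ × Covers G P′ v
      respond P (F , VF , rep , good) (reps , few , complete) v =
        -- The answer starts from `selected reps`, since repetitions may make `F` longer than the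
        -- number of components. The added `D` is the slack for challenges on the right.
        let F′ , S⊆F′ , VF′ , good′ , v∈F′ =
              answer t (length reps + D) (sizes′ (length reps) few) valid-S good-S
                (≤-trans (≤-reflexive (+-comm D _)) (+-monoˡ-≤ D (length-selected reps))) v
            rep′ = represents-subgraph F′ VF′
        in subgraph F′ VF′ , (F′ , VF′ , rep′ , good′) ,
           keeps VF VF′ rep rep′ (S⊆F′ ∘ F⊆S) , from (vertices rep′ v) v∈F′
        where
        open Component VF rep
        F⊆S : F ⊆ selected reps
        F⊆S = F⊆selected complete
        valid-S : Valid (selected reps)
        valid-S = record { wf = wf VF ∘ selected⊆F reps
                         ; coincide = λ x y → coincide VF (selected⊆F reps x) (selected⊆F reps y) }
        good-S : Good t (selected reps)
        good-S A A≤t = let F′ , F⊆F′ , rest-of = good A A≤t in F′ , F⊆F′ ∘ selected⊆F reps , rest-of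

-- Integer and rational estimates for the parameters.

module Arithmetic where
  open import Data.Nat as ℕ using (ℕ)
  import Data.Nat.Properties as ℕ
  open import Data.Integer as ℤ using (ℤ; +_; -[1+_])
  import Data.Integer.Properties as ℤ
  open import Data.Rational
  open import Data.Rational.Properties
  open import Data.Rational.Unnormalised as ℚᵘ using (ℚᵘ; mkℚᵘ; *≡*)
  import Data.Rational.Unnormalised.Properties as ℚᵘ
  open import Data.Empty using (⊥-elim)
  open import Relation.Nullary using (yes; no)
  open import Relation.Nullary.Decidable using (from-yes)
  open import Relation.Binary.PropositionalEquality using (_≡_; refl; sym; trans; cong; cong₂; subst)

  -- `z / 1` is normalised by a gcd and does not compute for a variable `z`. The unnormalised
  -- fraction does; its second field is the denominator minus one.
  toℚᵘ-ℤ→ℚ : ∀ z → toℚᵘ (ℤ→ℚ z) ℚᵘ.≃ mkℚᵘ z 0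
  toℚᵘ-ℤ→ℚ z = toℚᵘ-fromℚᵘ (mkℚᵘ z 0)

  ℤ→ℚ-* : ∀ a b → ℤ→ℚ (a ℤ.* b) ≡ ℤ→ℚ a * ℤ→ℚ b
  ℤ→ℚ-* a b = toℚᵘ-injective (ℚᵘ.≃-trans (toℚᵘ-ℤ→ℚ (a ℤ.* b)) (ℚᵘ.≃-sym
    (ℚᵘ.≃-trans (toℚᵘ-homo-* (ℤ→ℚ a) (ℤ→ℚ b)) (ℚᵘ.*-cong (toℚᵘ-ℤ→ℚ a) (toℚᵘ-ℤ→ℚ b)))))

  ℤ→ℚ-+ : ∀ a b → ℤ→ℚ (a ℤ.+ b) ≡ ℤ→ℚ a + ℤ→ℚ b
  ℤ→ℚ-+ a b = toℚᵘ-injective (ℚᵘ.≃-trans (toℚᵘ-ℤ→ℚ (a ℤ.+ b)) (ℚᵘ.≃-sym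
    (ℚᵘ.≃-trans (toℚᵘ-homo-+ (ℤ→ℚ a) (ℤ→ℚ b))
    (ℚᵘ.≃-trans (ℚᵘ.+-cong (toℚᵘ-ℤ→ℚ a) (toℚᵘ-ℤ→ℚ b))
      (*≡* (cong (ℤ._* + 1) (cong₂ ℤ._+_ (ℤ.*-identityʳ a) (ℤ.*-identityʳ b))))))))

  ℤ→ℚ-mono-≤ : ∀ {a b} → a ℤ.≤ b → ℤ→ℚ a ≤ ℤ→ℚ b
  ℤ→ℚ-mono-≤ {a} {b} a≤b = toℚᵘ-cancel-≤
    (ℚᵘ.≤-respˡ-≃ (ℚᵘ.≃-sym (toℚᵘ-ℤ→ℚ a)) (ℚᵘ.≤-respʳ-≃ (ℚᵘ.≃-sym (toℚᵘ-ℤ→ℚ b))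
      (ℚᵘ.*≤* (ℤ.*-monoʳ-≤-nonNeg (+ 1) a≤b))))

  ℤ→ℚ-cancel-≤ : ∀ {a b} → ℤ→ℚ a ≤ ℤ→ℚ b → a ℤ.≤ b
  ℤ→ℚ-cancel-≤ {a} {b} le
    with ℚᵘ.*≤* le′ ← ℚᵘ.≤-respˡ-≃ (toℚᵘ-ℤ→ℚ a) (ℚᵘ.≤-respʳ-≃ (toℚᵘ-ℤ→ℚ b) (toℚᵘ-mono-≤ le))
    = ℤ.*-cancelʳ-≤-pos a b (+ 1) le′

  ℤ→ℚ-cancel-< : ∀ {a b} → ℤ→ℚ a < ℤ→ℚ b → a ℤ.< b
  ℤ→ℚ-cancel-< {a} {b} lt with b ℤ.≤? a
  ... | yes b≤a = ⊥-elim (<-irrefl refl (<-≤-trans lt (ℤ→ℚ-mono-≤ b≤a)))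
  ... | no  b≰a = ℤ.≰⇒> b≰a

  ℕ→ℚ-* : ∀ a b → ℕ→ℚ (a ℕ.* b) ≡ ℕ→ℚ a * ℕ→ℚ b
  ℕ→ℚ-* a b = trans (cong ℤ→ℚ (ℤ.pos-* a b)) (ℤ→ℚ-* (+ a) (+ b))

  ℕ→ℚ-+ : ∀ a b → ℕ→ℚ (a ℕ.+ b) ≡ ℕ→ℚ a + ℕ→ℚ b
  ℕ→ℚ-+ a b = trans (cong ℤ→ℚ (ℤ.pos-+ a b)) (ℤ→ℚ-+ (+ a) (+ b))

  ℕ→ℚ-nonNeg : ∀ k → NonNegative (ℕ→ℚ k)
  ℕ→ℚ-nonNeg k = nonNegative (ℤ→ℚ-mono-≤ {+ 0} {+ k} (ℤ.+≤+ ℕ.z≤n))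

  ÷′-*-cancel : ∀ p q .{{_ : Positive q}} → (p ÷' q) * q ≡ p
  ÷′-*-cancel p q with q ≟ 0ℚ
  ... | no q≢0 = trans (*-assoc p _ q)
    (trans (cong (p *_) (*-inverseˡ q {{≢-nonZero q≢0}})) (*-identityʳ p))
  ÷′-*-cancel p .0ℚ {{()}} | yes refl

  1/23 : ℚ
  1/23 = + 1 / 23

  -- The default 0 is safe: for negative `s` it leaves only the empty set, whose expansion
  -- inequality is trivial, and a negative `d` leaves no right vertex at all, since degrees are
  -- nonnegative.
  nonNegPart : ℤ → ℕ
  nonNegPart (+ k)    = k
  nonNegPart -[1+ _ ] = 0

  ≤-nonNegPart : ∀ k z → + k ℤ.≤ z → k ℕ.≤ nonNegPart z
  ≤-nonNegPart k (+ _) (ℤ.+≤+ k≤) = k≤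

  module _ {ε : ℚ} (ε>0 : 0ℚ < ε) (ε<1/23 : ε < 1/23) where

    private instance
      ε-pos : Positive ε
      ε-pos = positive ε>0
      ε-nonNeg : NonNegative ε
      ε-nonNeg = pos⇒nonNeg ε

    -- At `ε = 1/23` the expansion factor is 91/46, which is above 39/20, and it grows as `ε`
    -- shrinks.
    39/20≤ : + 39 / 20 ≤ ℕ→ℚ 2 - ε * (+ 1 / 2)
    39/20≤ = begin
      + 39 / 20                     ≤⟨ from-yes (+ 39 / 20 ≤? ℕ→ℚ 2 - 1/23 * (+ 1 / 2)) ⟩
      ℕ→ℚ 2 - 1/23 * (+ 1 / 2)      ≤⟨ +-monoʳ-≤ (ℕ→ℚ 2) (neg-antimono-≤ (*-monoʳ-≤-nonNeg (+ 1 / 2) (<⇒≤ ε<1/23))) ⟩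
      ℕ→ℚ 2 - ε * (+ 1 / 2)         ∎
      where open ≤-Reasoning

    expansion-ℕ : ∀ x N → (ℕ→ℚ 2 - ε * (+ 1 / 2)) * ℕ→ℚ x ≤ ℕ→ℚ N → 39 ℕ.* x ℕ.≤ 20 ℕ.* N
    expansion-ℕ x N h = ℤ.drop‿+≤+ (ℤ→ℚ-cancel-≤ (begin
      ℕ→ℚ (39 ℕ.* x)                                ≡⟨ ℕ→ℚ-* 39 x ⟩
      ℕ→ℚ 20 * (+ 39 / 20) * ℕ→ℚ x                  ≡⟨ *-assoc (ℕ→ℚ 20) (+ 39 / 20) (ℕ→ℚ x) ⟩
      ℕ→ℚ 20 * ((+ 39 / 20) * ℕ→ℚ x)                ≤⟨ *-monoˡ-≤-nonNeg (ℕ→ℚ 20) (≤-trans (*-monoʳ-≤-nonNeg (ℕ→ℚ x) {{ℕ→ℚ-nonNeg x}} 39/20≤) h) ⟩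
      ℕ→ℚ 20 * ℕ→ℚ N                                ≡⟨ sym (ℕ→ℚ-* 20 N) ⟩
      ℕ→ℚ (20 ℕ.* N)                                ∎))
      where open ≤-Reasoning

    μ : ℤ → ℤ → ℚ
    μ s d = ((ε * ℤ→ℚ s) ÷' ((ℕ→ℚ 72 * ℤ→ℚ d) + (ℕ→ℚ 2 * ε))) - ℤ→ℚ d

    -- `k + D` lies below the quotient in `μ`. Multiplying by the denominator and dropping the
    -- nonnegative multiple of `2 ε` on the left gives the bound.
    below-μ : ∀ s k D → ℕ→ℚ k < μ s (+ D) → ℕ→ℚ ((k ℕ.+ D) ℕ.* (72 ℕ.* D)) < ε * ℤ→ℚ s
    below-μ s k D k<μ = begin-strict
      ℕ→ℚ ((k ℕ.+ D) ℕ.* (72 ℕ.* D))                       ≡⟨ ℕ→ℚ-* (k ℕ.+ D) (72 ℕ.* D) ⟩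
      ℕ→ℚ (k ℕ.+ D) * ℕ→ℚ (72 ℕ.* D)                       ≡⟨ cong₂ _*_ (ℕ→ℚ-+ k D) (ℕ→ℚ-* 72 D) ⟩
      (x + y) * (ℕ→ℚ 72 * y)                               ≡⟨ cong ((x + y) *_) (sym (+-identityʳ _)) ⟩
      (x + y) * (ℕ→ℚ 72 * y + 0ℚ)                          ≤⟨ *-monoˡ-≤-nonNeg (x + y) (+-monoʳ-≤ (ℕ→ℚ 72 * y) (nonNegative⁻¹ (ℕ→ℚ 2 * ε) {{2ε-nonNeg}})) ⟩
      (x + y) * q                                          <⟨ *-monoˡ-<-pos q x+y< ⟩
      ((ε * ℤ→ℚ s) ÷' q) * q                               ≡⟨ ÷′-*-cancel (ε * ℤ→ℚ s) q ⟩
      ε * ℤ→ℚ s                                            ∎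
      where
      open ≤-Reasoning
      x = ℕ→ℚ k
      y = ℕ→ℚ D
      q = ℕ→ℚ 72 * y + ℕ→ℚ 2 * ε
      2ε-nonNeg : NonNegative (ℕ→ℚ 2 * ε)
      2ε-nonNeg = nonNeg*nonNeg⇒nonNeg (ℕ→ℚ 2) ε
      instance
        x+y-nonNeg : NonNegative (x + y)
        x+y-nonNeg = nonNeg+nonNeg⇒nonNeg x {{ℕ→ℚ-nonNeg k}} y {{ℕ→ℚ-nonNeg D}}
        q-pos : Positive q
        q-pos = nonNeg+pos⇒pos (ℕ→ℚ 72 * y) {{nonNeg*nonNeg⇒nonNeg (ℕ→ℚ 72) y {{ℕ→ℚ-nonNeg D}}}}
                               (ℕ→ℚ 2 * ε) {{pos*pos⇒pos (ℕ→ℚ 2) ε}}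
      x+y< : x + y < (ε * ℤ→ℚ s) ÷' q
      x+y< = subst (x + y <_)
        (trans (+-assoc ((ε * ℤ→ℚ s) ÷' q) (- y) y) (trans (cong (λ z → ((ε * ℤ→ℚ s) ÷' q) + z) (+-inverseˡ y)) (+-identityʳ _)))
        (+-monoˡ-< y k<μ)

    -- As `ε` is below 1/23, the product is at most `s / 23` when `s` is nonnegative. For negative
    -- `s` it could not exceed a natural number.
    <ε*s⇒23*< : ∀ s a → ℕ→ℚ a < ε * ℤ→ℚ s → 23 ℕ.* a ℕ.< nonNegPart s
    <ε*s⇒23*< -[1+ j ] a a< with ℤ→ℚ-cancel-< {+ a} {+ 0} (begin-strict
      ℕ→ℚ a               <⟨ a< ⟩
      ε * ℤ→ℚ -[1+ j ]    ≤⟨ *-monoˡ-≤-nonNeg ε (ℤ→ℚ-mono-≤ { -[1+ j ]} {+ 0} ℤ.-≤+) ⟩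
      ε * 0ℚ              ≡⟨ *-zeroʳ ε ⟩
      0ℚ                  ∎)
      where open ≤-Reasoning
    ... | ℤ.+<+ ()
    <ε*s⇒23*< (+ S) a a< = ℤ.drop‿+<+ (ℤ→ℚ-cancel-< (begin-strict
      ℕ→ℚ (23 ℕ.* a)               ≡⟨ ℕ→ℚ-* 23 a ⟩
      ℕ→ℚ 23 * ℕ→ℚ a               <⟨ *-monoʳ-<-pos (ℕ→ℚ 23) a< ⟩
      ℕ→ℚ 23 * (ε * ℕ→ℚ S)         ≤⟨ *-monoˡ-≤-nonNeg (ℕ→ℚ 23) (*-monoʳ-≤-nonNeg (ℕ→ℚ S) {{ℕ→ℚ-nonNeg S}} (<⇒≤ ε<1/23)) ⟩
      ℕ→ℚ 23 * (1/23 * ℕ→ℚ S)      ≡⟨ sym (*-assoc (ℕ→ℚ 23) 1/23 (ℕ→ℚ S)) ⟩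
      1ℚ * ℕ→ℚ S                   ≡⟨ *-identityˡ (ℕ→ℚ S) ⟩
      ℕ→ℚ S                        ∎))
      where open ≤-Reasoning

    -- As `1 ≤ D`, the summand 10 is at most `10 * D`. With `K = k + D` the left side is then at
    -- most 64 · 20 · K · D, that is 1280 K D, while the right side is 23 · 72 · K · D, that is 1656
    -- K D.
    sizes-ℕ : ∀ k D → 1 ℕ.≤ D → (10 ℕ.+ 54 ℕ.* D) ℕ.* (20 ℕ.* (k ℕ.+ D)) ℕ.≤ 23 ℕ.* ((k ℕ.+ D) ℕ.* (72 ℕ.* D))
    sizes-ℕ k D 1≤D = begin
      (10 ℕ.+ 54 ℕ.* D) ℕ.* (20 ℕ.* K)            ≤⟨ ℕ.*-monoˡ-≤ (20 ℕ.* K) (ℕ.+-monoˡ-≤ (54 ℕ.* D) (ℕ.*-monoʳ-≤ 10 1≤D)) ⟩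
      (10 ℕ.* D ℕ.+ 54 ℕ.* D) ℕ.* (20 ℕ.* K)      ≡⟨ solve 2 (λ K D → (con 10 :* D :+ con 54 :* D) :* (con 20 :* K) := con 1280 :* (K :* D)) refl K D ⟩
      1280 ℕ.* (K ℕ.* D)                          ≤⟨ ℕ.*-monoˡ-≤ (K ℕ.* D) (from-yes (1280 ℕ.≤? 1656)) ⟩
      1656 ℕ.* (K ℕ.* D)                          ≡⟨ solve 2 (λ K D → con 1656 :* (K :* D) := con 23 :* (K :* (con 72 :* D))) refl K D ⟩
      23 ℕ.* (K ℕ.* (72 ℕ.* D))                   ∎
      where
      open ℕ.≤-Reasoning
      open import Data.Nat.Solver using (module +-*-Solver)
      open +-*-Solver
      K = k ℕ.+ D

    below-μ⇒sizes : ∀ s d k → ℕ→ℚ k < μ s d → 1 ℕ.≤ nonNegPart d →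
      (10 ℕ.+ 54 ℕ.* nonNegPart d) ℕ.* (20 ℕ.* (k ℕ.+ nonNegPart d)) ℕ.≤ nonNegPart s
    below-μ⇒sizes s (+ D) k k<μ 1≤D =
      ℕ.≤-trans (sizes-ℕ k D 1≤D) (ℕ.<⇒≤ (<ε*s⇒23*< s ((k ℕ.+ D) ℕ.* (72 ℕ.* D)) (below-μ s k D k<μ)))

    expander-ℕ : ∀ G s → IsExpander G s (ℕ→ℚ 2 - ε * (+ 1 / 2)) →
      ∀ X → card X ℕ.≤ nonNegPart s → 39 ℕ.* card X ℕ.≤ 20 ℕ.* card (nbhd G X)
    expander-ℕ G (+ S) exp X X≤S =
      expansion-ℕ (card X) (card (nbhd G X)) (exp X (ℤ→ℚ-mono-≤ {+ card X} {+ S} (ℤ.+≤+ X≤S)))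
    -- Here `card X` is 0, and so is the left side.
    expander-ℕ G -[1+ _ ] exp X X≤0 rewrite ℕ.n≤0⇒n≡0 X≤0 = ℕ.z≤n

-- The game argument applied to the integer and rational parameters.

open import Data.Rational using (ℚ; 0ℚ; _<_; _≤_; _*_; _+_; _-_; _/_)

theorem8 : (G : BipGraph) (s d : ℤ) (ε : ℚ) →
    0ℚ < ε → ε < (Data.Integer.+ 1) / 23 →
    (∀ (l : Fin (BipGraph.m G)) → degL G l ≡ 3) →
    (∀ (r : Fin (BipGraph.n G)) → ℤ→ℚ (Data.Integer.+ degR G r) ≤ ℤ→ℚ d) →
    IsExpander G s (ℕ→ℚ 2 - (ε * (Data.Integer.+ 1 / 2))) →
    CovererWins G (((ε * ℤ→ℚ s) ÷' ((ℕ→ℚ 72 * ℤ→ℚ d) + (ℕ→ℚ 2 * ε))) - ℤ→ℚ d)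
theorem8 G s d ε ε>0 ε<1/23 deg≡3 degR≤d expander =
  Game.Winning.covererWins G deg≡3 (nonNegPart s) (nonNegPart d)
    (λ r → ≤-nonNegPart (degR G r) d (ℤ→ℚ-cancel-≤ (degR≤d r)))
    (expander-ℕ ε>0 ε<1/23 G s expander) (μ ε>0 ε<1/23 s d) (below-μ⇒sizes ε>0 ε<1/23 s d)
  where open Arithmetic
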